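{- The following statements hold: (1) $\mathbf{KB(C)}$ is weakly complete for $\mathrm{ELC}^s$: every s-valid $\mathcal{ELC}$-formula is a theorem of $\mathbf{KB(C)}$; (2) $\mathbf{K(CM)}$ is weakly complete for $\mathrm{ELCM}$: every valid $\mathcal{ELCM}$-formula is a theorem of $\mathbf{K(CM)}$; (3) $\mathbf{KB(CM)}$ is weakly complete for $\mathrm{ELCM}^s$: every s-valid $\mathcal{ELCM}$-formula is a theorem of $\mathbf{KB(CM)}$; (4) $\mathbf{KB(CD)}$ is weakly complete for $\mathrm{ELCD}^s$: every s-valid $\mathcal{ELCD}$-formula is a theorem of $\mathbf{KB(CD)}$.
   Context: Languages. Fix a countably infinite set $\mathsf{Prop}$ and a finite nonempty set $\mathsf{Ag}$ of agents; groups are nonempty subsets of $\mathsf{Ag}$. $\mathcal{ELC}$-formulas: $\varphi::=p\mid\neg\varphi\mid(\varphi\to\varphi)\mid K_a\varphi\mid C_G\varphi$ ($p\in\mathsf{Prop}$, $a\in\mathsf{Ag}$, $G$ a group); $\mathcal{ELCD}$ adds $D_G\varphi$ and $\mathcal{ELCM}$ adds $M_G\varphi$ to this grammar. $E_G\varphi:=\bigwedge_{a\in G}K_a\varphi$, $E_G^1\varphi:=E_G\varphi$, $E_G^{n}\varphi:=E_GE_G^{n-1}\varphi$. Models. A model is $M=(W,A,E,C,\nu)$ with $W\neq\emptyset$, $A$ an arbitrary set, $E:W\times W\to\wp(A)$, $C:\mathsf{Ag}\to\wp(A)$, $\nu:W\to\wp(\mathsf{Prop})$. It is a similarity model if for all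 $s,t\in W$: $E(s,t)=A$ implies $s=t$, and $E(s,t)=E(t,s)$. Satisfaction: $M,s\models p$ iff $p\in\nu(s)$; Booleans as usual; $M,s\models K_a\psi$ iff $M,t\models\psi$ for all $t$ with $C(a)\subseteq E(s,t)$; $M,s\models C_G\psi$ iff $M,s\models E_G^n\psi$ for all $n\ge1$; $M,s\models D_G\psi$ iff $M,t\models\psi$ for all $t$ with $\bigcup_{a\in G}C(a)\subseteq E(s,t)$; $M,s\models M_G\psi$ iff $M,t\models\psi$ for all $t$ with $\bigcap_{a\in G}C(a)\subseteq E(s,t)$. A formula is valid (s-valid) if true at all states of all models (all similarity models). $\mathrm{ELCM}$ is the set of valid $\mathcal{ELCM}$-formulas; $\mathrm{ELC}^s$, $\mathrm{ELCM}^s$, $\mathrm{ELCD}^s$ are the sets of s-valid formulas of $\mathcal{ELC}$, $\mathcal{ELCM}$, $\mathcal{ELCD}$, respectively. Axiomatic systems (schemes over the respective language). $\mathbf K$: all instances of propositional tautologies; $K_a(\varphi\to\psi)\to(K_a\varphi\to K_a\psi)$; rules: from $\varphi$ and $\varphi\to\psi$ infer $\psi$; from $\varphi$ infer $K_a\varphi$. $\mathbf{KB}$: $\mathbf K$ plus $\varphi\to K_a\neg K_a\neg\varphi$. $\mathbf C$: axiom $C_G\varphi\to\bigwedge_{a\in G}K_a(\varphi\wedge C_G\varphi)$; rule: from $\varphi\to\bigwedge_{a\in G}K_a(\varphi\wedge\psi)$ infer $\varphi\to C_G\psi$. $\mathbf{B(D)}$: axioms $D_G(\varphi\to\psi)\to(D_G\varphi\to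 D_G\psi)$; $D_{\{a\}}\varphi\leftrightarrow K_a\varphi$; $D_G\varphi\to D_H\varphi$ for $G\subseteq H$; $\varphi\to D_G\neg D_G\neg\varphi$. $\mathbf M$: axioms $M_G(\varphi\to\psi)\to(M_G\varphi\to M_G\psi)$; $M_{\{a\}}\varphi\leftrightarrow K_a\varphi$; $M_G\varphi\to M_H\varphi$ for $H\subseteq G$. $\mathbf{B(M)}$: $\mathbf M$ plus $\varphi\to M_G\neg M_G\neg\varphi$. Then $\mathbf{KB(C)}=\mathbf{KB}+\mathbf C$, $\mathbf{K(CM)}=\mathbf K+\mathbf C+\mathbf M$, $\mathbf{KB(CM)}=\mathbf{KB}+\mathbf C+\mathbf{B(M)}$, $\mathbf{KB(CD)}=\mathbf{KB}+\mathbf C+\mathbf{B(D)}$, where $+$ is union of axioms and rules.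
   Formalization: System M (hence B(M), K(CM), KB(CM)) is given the extra rule "from φ infer M_Gφ"; without it parts (2) and (3) fail when there are at least two agents, since the valid formula M_G(p→p) with |G|=2 is not derivable. -}

module Defs where

open import Data.Bool using (Bool; true; not; _∨_)
open import Data.Empty using (⊥; ⊥-elim-irr)
open import Data.Fin using (Fin)
import Data.Fin.Subset as Subset
open import Data.Fin.Subset using (Subset; Nonempty; ⁅_⁆)
open import Data.Fin.Subset.Properties using (_∈?_; x∈⁅x⁆)
open import Data.List using (List; []; _∷_; allFin; filter)
open import Data.List.Membership.Propositional using () renaming (_∈_ to _∈ˡ_)
open import Data.List.Membership.Propositional.Properties using (∈-filter⁺; ∈-allFin)
open import Data.List.NonEmpty using (List⁺; _∷_; foldr₁)
import Data.List.NonEmpty as List⁺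
open import Data.List.Relation.Unary.All using (All)
open import Data.Nat using (ℕ; zero; suc; _≤_)
open import Data.Product using (_×_; _,_; ∃-syntax)
open import Function using (_∘_; _⇔_; mk⇔)
open import Level using (Level; 0ℓ)
open import Relation.Binary.Core using (REL)
open import Relation.Binary.PropositionalEquality using (_≡_; _≢_; refl; sym; trans; cong; subst)
open import Relation.Nullary using (¬_)
open import Relation.Unary using (Pred; _∈_; _⊆_; _≐_; _∪_; U)

infixr 5 _⇒_
infix  8 ~_
infix  2 _⊢_

private
  variable
    ℓ : Level
    n : ℕ

-- The proof of nonemptiness is irrelevant, so that a group is determined by
-- its set of members and C_G, D_G, M_G do not depend on the proof.
record Group (n : ℕ) : Set where
  constructor group
  field
    members   : Subset n
    .nonempty : Nonempty members

open Group public

singleton : Fin n → Group n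
singleton a = group ⁅ a ⁆ (a , x∈⁅x⁆ a)

infix 4 _∈ᴳ_ _⊆ᴳ_

_∈ᴳ_ : Fin n → Group n → Set
a ∈ᴳ G = a Subset.∈ members G

_⊆ᴳ_ : Group n → Group n → Set
G ⊆ᴳ H = members G Subset.⊆ members H

elements : Subset n → List (Fin n)
elements p = filter (_∈? p) (allFin _)

elements-nonempty : (p : Subset n) → Nonempty p → elements p ≢ []
elements-nonempty p (a , a∈p) eq
  with () ← subst (a ∈ˡ_) eq (∈-filter⁺ (_∈? p) (∈-allFin a) a∈p)

toList⁺ : {A : Set} (xs : List A) → .(xs ≢ []) → List⁺ A
toList⁺ []       ne = ⊥-elim-irr (ne refl)
toList⁺ (x ∷ xs) _  = x ∷ xs

-- The members of a group in increasing order, without repetition.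
agents : Group n → List⁺ (Fin n)
agents (group p ne) = toList⁺ (elements p) (elements-nonempty p ne)

-- Abbreviations over ¬, → and K_a.  They are used twice: for formulas, and for
-- sets of states, where they give the meaning of the formulas E_G^m φ.
module Abbreviations {X : Set ℓ} (neg : X → X) (imp : X → X → X)
                     (know : Fin n → X → X) where

  infixr 6 _∧_
  infix  4 _⇿_

  _∧_ : X → X → X
  x ∧ y = neg (imp x (neg y))

  _⇿_ : X → X → X
  x ⇿ y = imp x y ∧ imp y x

  ⋀[_] : Group n → (Fin n → X) → X
  ⋀[ G ] f = foldr₁ _∧_ (List⁺.map f (agents G))

  E : Group n → X → X
  E G x = ⋀[ G ] λ a → know a x

  -- E^ 0 is the identity, so that E^ 1 G is E G.
  E^ : ℕ → Group n → X → X
  E^ zero    G x = x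
  E^ (suc m) G x = E G (E^ m G x)

data Language : Set where
  ELC ELCM ELCD : Language

-- Propositional variables are natural numbers, agents are elements of Fin n.
data Form (n : ℕ) : Language → Set where
  var : ∀ {L} → ℕ → Form n L
  ~_  : ∀ {L} → Form n L → Form n L
  _⇒_ : ∀ {L} → Form n L → Form n L → Form n L
  K   : ∀ {L} → Fin n → Form n L → Form n L
  C   : ∀ {L} → Group n → Form n L → Form n L
  D   : Group n → Form n ELCD → Form n ELCD
  M   : Group n → Form n ELCM → Form n ELCM

private
  variable
    L : Language

module _ {n : ℕ} {L : Language} where
  open Abbreviations {X = Form n L} ~_ _⇒_ K public

record Model (n : ℕ) : Set₁ where
  field
    W     : Set
    point : W
    A     : Set
    edge  : W → W → Pred A 0ℓ
    cap   : Fin n → Pred A 0ℓ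
    val   : W → Pred ℕ 0ℓ

  ⋃cap ⋂cap : Group n → Pred A 0ℓ
  ⋃cap G x = ∃[ a ] a ∈ᴳ G × x ∈ cap a
  ⋂cap G x = ∀ a → a ∈ᴳ G → x ∈ cap a

  Not : Pred W 0ℓ → Pred W 0ℓ
  Not P s = ¬ P s

  Imp : Pred W 0ℓ → Pred W 0ℓ → Pred W 0ℓ
  Imp P Q s = P s → Q s

  Box : Pred A 0ℓ → Pred W 0ℓ → Pred W 0ℓ
  Box X P s = ∀ t → X ⊆ edge s t → P t

  module Sem = Abbreviations Not Imp (λ a → Box (cap a))

  -- The clause for C is recursive in φ only; Sat-C below is the clause
  -- in terms of the formulas E_G^m φ.
  Sat : Form n L → Pred W 0ℓ
  Sat (var p) s = p ∈ val s
  Sat (~ φ)     = Not (Sat φ)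
  Sat (φ ⇒ ψ)   = Imp (Sat φ) (Sat ψ)
  Sat (K a φ)   = Box (cap a) (Sat φ)
  Sat (C G φ) s = ∀ m → 1 ≤ m → Sem.E^ m G (Sat φ) s
  Sat (D G φ)   = Box (⋃cap G) (Sat φ)
  Sat (M G φ)   = Box (⋂cap G) (Sat φ)

  Sat-⋀ : (f : Fin n → Form n L) (a : Fin n) (as : List (Fin n)) →
          Sat (foldr₁ _∧_ (List⁺.map f (a ∷ as))) ≡
          foldr₁ Sem._∧_ (List⁺.map (Sat ∘ f) (a ∷ as))
  Sat-⋀ f a []       = refl
  Sat-⋀ f a (b ∷ as) = cong (Sat (f a) Sem.∧_) (Sat-⋀ f b as)

  Sat-E^ : ∀ m G (φ : Form n L) → Sat (E^ m G φ) ≡ Sem.E^ m G (Sat φ)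
  Sat-E^ zero    G φ = refl
  Sat-E^ (suc m) G φ =
    trans (Sat-⋀ (λ a → K a (E^ m G φ)) (List⁺.head (agents G)) (List⁺.tail (agents G)))
          (cong (Sem.E G) (Sat-E^ m G φ))

  Sat-C : ∀ G (φ : Form n L) s →
          Sat (C G φ) s ⇔ (∀ m → 1 ≤ m → Sat (E^ m G φ) s)
  Sat-C G φ s = mk⇔
    (λ h m 1≤m → subst (λ P → P s) (sym (Sat-E^ m G φ)) (h m 1≤m))
    (λ h m 1≤m → subst (λ P → P s) (Sat-E^ m G φ) (h m 1≤m))

infix 4 _,_⊨_

_,_⊨_ : (𝓜 : Model n) → Model.W 𝓜 → Form n L → Set
𝓜 , s ⊨ φ = Model.Sat 𝓜 φ s

record IsSimilarity (𝓜 : Model n) : Set where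
  open Model 𝓜
  field
    full⇒≡    : ∀ s t → edge s t ≐ U → s ≡ t
    symmetric : ∀ s t → edge s t ≐ edge t s

Valid : Form n L → Set₁
Valid φ = ∀ 𝓜 s → 𝓜 , s ⊨ φ

SValid : Form n L → Set₁
SValid φ = ∀ 𝓜 → IsSimilarity 𝓜 → ∀ s → 𝓜 , s ⊨ φ

data PL : Set where
  atom : ℕ → PL
  neg  : PL → PL
  imp  : PL → PL → PL

eval : (ℕ → Bool) → PL → Bool
eval v (atom i)  = v i
eval v (neg θ)   = not (eval v θ)
eval v (imp θ η) = not (eval v θ) ∨ eval v η

Tautology : PL → Set
Tautology θ = ∀ v → eval v θ ≡ true

instantiate : (ℕ → Form n L) → PL → Form n L
instantiate σ (atom i)  = σ i
instantiate σ (neg θ)   = ~ instantiate σ θ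
instantiate σ (imp θ η) = instantiate σ θ ⇒ instantiate σ η

-- Rule Γ φ: from the premises Γ infer φ.
record System (n : ℕ) (L : Language) : Set₁ where
  constructor system
  field
    Axiom : Pred (Form n L) 0ℓ
    Rule  : REL (List (Form n L)) (Form n L) 0ℓ

open System public

NoRule : REL (List (Form n L)) (Form n L) 0ℓ
NoRule _ _ = ⊥

infixl 6 _⊕_

_⊕_ : System n L → System n L → System n L
S ⊕ T = system (Axiom S ∪ Axiom T) (λ Γ → Rule S Γ ∪ Rule T Γ)

data _⊢_ (S : System n L) : Form n L → Set where
  axiom : ∀ {φ} → Axiom S φ → S ⊢ φ
  rule  : ∀ {Γ φ} → Rule S Γ φ → All (S ⊢_) Γ → S ⊢ φ

data AxiomK {n L} : Pred (Form n L) 0ℓ where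
  taut : ∀ θ → Tautology θ → ∀ σ → AxiomK (instantiate σ θ)
  dist : ∀ a φ ψ → AxiomK (K a (φ ⇒ ψ) ⇒ (K a φ ⇒ K a ψ))

data RuleK {n L} : REL (List (Form n L)) (Form n L) 0ℓ where
  mp  : ∀ φ ψ → RuleK (φ ∷ (φ ⇒ ψ) ∷ []) ψ
  nec : ∀ a φ → RuleK (φ ∷ []) (K a φ)

data AxiomB {n L} : Pred (Form n L) 0ℓ where
  symm : ∀ a φ → AxiomB (φ ⇒ K a (~ K a (~ φ)))

data AxiomC {n L} : Pred (Form n L) 0ℓ where
  unfold : ∀ G φ → AxiomC (C G φ ⇒ ⋀[ G ] λ a → K a (φ ∧ C G φ))

data RuleC {n L} : REL (List (Form n L)) (Form n L) 0ℓ where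
  induct : ∀ G φ ψ → RuleC ((φ ⇒ ⋀[ G ] λ a → K a (φ ∧ ψ)) ∷ []) (φ ⇒ C G ψ)

data AxiomBD {n} : Pred (Form n ELCD) 0ℓ where
  dist : ∀ G φ ψ → AxiomBD (D G (φ ⇒ ψ) ⇒ (D G φ ⇒ D G ψ))
  sing : ∀ a φ → AxiomBD (D (singleton a) φ ⇿ K a φ)
  mono : ∀ G H φ → G ⊆ᴳ H → AxiomBD (D G φ ⇒ D H φ)
  symm : ∀ G φ → AxiomBD (φ ⇒ D G (~ D G (~ φ)))

data AxiomM {n} : Pred (Form n ELCM) 0ℓ where
  dist : ∀ G φ ψ → AxiomM (M G (φ ⇒ ψ) ⇒ (M G φ ⇒ M G ψ))
  sing : ∀ a φ → AxiomM (M (singleton a) φ ⇿ K a φ)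
  anti : ∀ G H φ → H ⊆ᴳ G → AxiomM (M G φ ⇒ M H φ)

-- Necessitation for M_G, which presentations listing only the axioms for M_G
-- leave out, has to be a rule of its own.  Necessitation for D_G follows from
-- K_a φ → D_{a} φ → D_G φ, but without a rule for M_G the valid formula
-- M_G (p → p) is not a theorem when G has two or more members.
data RuleM {n} : REL (List (Form n ELCM)) (Form n ELCM) 0ℓ where
  nec : ∀ G φ → RuleM (φ ∷ []) (M G φ)

data AxiomBM {n} : Pred (Form n ELCM) 0ℓ where
  symm : ∀ G φ → AxiomBM (φ ⇒ M G (~ M G (~ φ)))

𝐊 𝐊𝐁 𝐂 𝐊𝐁[𝐂] : System n L
𝐊     = system AxiomK RuleK
𝐊𝐁    = 𝐊 ⊕ system AxiomB NoRule
𝐂     = system AxiomC RuleC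
𝐊𝐁[𝐂] = 𝐊𝐁 ⊕ 𝐂

𝐌 𝐁[𝐌] 𝐊[𝐂𝐌] 𝐊𝐁[𝐂𝐌] : System n ELCM
𝐌      = system AxiomM RuleM
𝐁[𝐌]   = 𝐌 ⊕ system AxiomBM NoRule
𝐊[𝐂𝐌]  = 𝐊 ⊕ 𝐂 ⊕ 𝐌
𝐊𝐁[𝐂𝐌] = 𝐊𝐁 ⊕ 𝐂 ⊕ 𝐁[𝐌]

𝐁[𝐃] 𝐊𝐁[𝐂𝐃] : System n ELCD
𝐁[𝐃]   = system AxiomBD NoRule
𝐊𝐁[𝐂𝐃] = 𝐊𝐁 ⊕ 𝐂 ⊕ 𝐁[𝐃]

-- Completeness is proved by pruning, so that it yields a derivation without
-- deciding provability first.  Start from all valuations of the subformulas of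
-- φ₀ and repeatedly discard a valuation that is provably inconsistent: one that
-- violates a Boolean clause, lacks a witness for a false box, or makes C_G φ false
-- although no G-path leads to a failure of φ.  In the last case the disjunction
-- of the valuations from which there is no such path is an invariant for the
-- induction rule.  The survivors carry a finite pseudo-model, whose arrows are
-- given syntactically, and it is turned into a model over sets of abilities.
-- If φ₀ is true in that model, every valuation falsifying φ₀ was refuted, and
-- hence φ₀ is provable.
module Submission where

open import Defs
open import Data.Bool using (Bool; true; false; not; _∨_; T; if_then_else_; _xor_)
import Data.Bool as Bool
import Data.Bool.Properties as Bool
open import Data.Empty using (⊥; ⊥-elim; ⊥-elim-irr)
open import Data.Fin using (Fin)
import Data.Fin as Fin
import Data.Fin.Subset as Subset
open import Data.Fin.Subset using (Subset; ⁅_⁆)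
open import Data.Fin.Subset.Properties
  using (x∈⁅x⁆; x∈⁅y⁆⇒x≡y; nonempty?; _⊆?_) renaming (_∈?_ to _∈ˢ?_)
open import Data.List using (List; []; _∷_; _++_; map; concatMap; filter; length; allFin)
import Data.List.Membership.DecPropositional as DecMembership
open import Data.List.Membership.Propositional using (_∈_; _∉_; find; lose)
open import Data.List.Membership.Propositional.Properties
  using (∈-filter⁺; ∈-filter⁻; ∈-allFin; ∈-map⁺; ∈-++⁺ˡ; ∈-++⁺ʳ; ∈-++⁻; ∈-map⁻;
         ∈-concatMap⁺; ∈-concatMap⁻)
open import Data.List.NonEmpty using (foldr₁)
import Data.List.NonEmpty as List⁺
open import Data.List.Properties using (filter-notAll)
import Data.List.Properties as List
open import Data.List.Relation.Unary.All using ([]; _∷_)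
open import Data.List.Relation.Unary.Any using (Any; here; there; any?)
import Data.List.Relation.Unary.Any as Any
open import Data.Maybe using (Maybe; just; nothing)
open import Data.Nat using (ℕ; zero; suc; _<_; z≤n; s≤s; NonZero)
import Data.Nat as ℕ
open import Data.Nat.Induction using (<-wellFounded; Acc; acc)
open import Data.Product using (_×_; _,_; ∃-syntax; proj₁; proj₂; map₂)
open import Data.Sum using (_⊎_; inj₁; inj₂)
import Data.Sum as Sum
open import Data.Unit using (⊤; tt)
open import Data.Vec using ([]; _∷_)
import Data.Vec as Vec
import Data.Vec.Properties as VecP
open import Function using (_∘_; id)
open import Relation.Binary.Definitions using (DecidableEquality)
open import Relation.Binary.PropositionalEquality using (_≡_; _≢_; refl; sym; cong; cong₂; subst)
open import Relation.Nullary using (¬_; Dec; yes; no; does)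
open import Relation.Nullary.Decidable using (_×-dec_; _⊎-dec_; ¬?; T?; map′; recompute; decidable-stable)

private
  variable
    n : ℕ
    L : Language

-- Decidable equality of formulas.

-- Comparing constructors first leaves only the diagonal cases to `sameTag`.
tag : Form n L → ℕ
tag (var _) = 0
tag (~ _)   = 1
tag (_ ⇒ _) = 2
tag (K _ _) = 3
tag (C _ _) = 4
tag (D _ _) = 5
tag (M _ _) = 6

infix 4 _≟ᴳ_ _≟_

_≟ᴳ_ : DecidableEquality (Group n)
group p _ ≟ᴳ group q _ = map′ (λ { refl → refl }) (cong members) (VecP.≡-dec Bool._≟_ p q)

mutual
  _≟_ : DecidableEquality (Form n L)
  φ ≟ ψ with tag φ ℕ.≟ tag ψ
  ... | yes e  = sameTag φ ψ e
  ... | no  ne = no (ne ∘ cong tag)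

  sameTag : (φ ψ : Form n L) → tag φ ≡ tag ψ → Dec (φ ≡ ψ)
  sameTag (var p) (var q) _ = map′ (cong var) (λ { refl → refl }) (p ℕ.≟ q)
  sameTag (~ φ) (~ ψ) _ = map′ (cong ~_) (λ { refl → refl }) (φ ≟ ψ)
  sameTag (φ ⇒ φ′) (ψ ⇒ ψ′) _ =
    map′ (λ { (refl , refl) → refl }) (λ { refl → refl , refl }) ((φ ≟ ψ) ×-dec (φ′ ≟ ψ′))
  sameTag (K a φ) (K b ψ) _ =
    map′ (λ { (refl , refl) → refl }) (λ { refl → refl , refl }) ((a Fin.≟ b) ×-dec (φ ≟ ψ))
  sameTag (C G φ) (C H ψ) _ =
    map′ (λ { (refl , refl) → refl }) (λ { refl → refl , refl }) ((G ≟ᴳ H) ×-dec (φ ≟ ψ))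
  sameTag (D G φ) (D H ψ) _ =
    map′ (λ { (refl , refl) → refl }) (λ { refl → refl , refl }) ((G ≟ᴳ H) ×-dec (φ ≟ ψ))
  sameTag (M G φ) (M H ψ) _ =
    map′ (λ { (refl , refl) → refl }) (λ { refl → refl , refl }) ((G ≟ᴳ H) ×-dec (φ ≟ ψ))

-- Groups, box modalities and subformulas.

agentList : Group n → List (Fin n)
agentList G = elements (members G)

∈-agentList⁺ : ∀ (G : Group n) {a} → a ∈ᴳ G → a ∈ agentList G
∈-agentList⁺ G {a} a∈G = ∈-filter⁺ (_∈ˢ? members G) (∈-allFin a) a∈G

∈-agentList⁻ : ∀ (G : Group n) {a} → a ∈ agentList G → a ∈ᴳ G
∈-agentList⁻ {n} G a∈ = proj₂ (∈-filter⁻ (_∈ˢ? members G) {xs = allFin n} a∈)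

-- Nonemptiness is decidable, so a witness can be recomputed from the irrelevant proof.
someMember : (G : Group n) → ∃[ a ] a ∈ᴳ G
someMember (group p ne) = recompute (nonempty? p) ne

-- Common knowledge gets no arrows of its own: `C G` is treated through paths of `knows a` arrows
-- with `a` in `G`.
data Modality (n : ℕ) : Language → Set where
  knows       : ∀ {L} → Fin n → Modality n L
  mutually    : Group n → Modality n ELCM
  distributed : Group n → Modality n ELCD

box : Modality n L → Form n L → Form n L
box (knows a)       = K a
box (mutually G)    = M G
box (distributed G) = D G

holders : Modality n L → Subset n
holders (knows a)       = ⁅ a ⁆
holders (mutually G)    = members G
holders (distributed G) = members G

-- (i , β) ∈ demands α means that α → □ᵢ β is provable; a state containing α
-- requires its i-successors to contain β.
demands : Form n L → List (Modality n L × Form n L)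
demands (var _) = []
demands (~ _)   = []
demands (_ ⇒ _) = []
demands (K a φ) = (knows a , φ) ∷ []
demands (C G φ) = concatMap (λ a → (knows a , φ) ∷ (knows a , C G φ) ∷ []) (agentList G)
demands (D G φ) = (distributed G , φ) ∷ []
demands (M G φ) = (mutually G , φ) ∷ []

box-demand : ∀ (i : Modality n L) φ → (i , φ) ∈ demands (box i φ)
box-demand (knows a)       φ = here refl
box-demand (mutually G)    φ = here refl
box-demand (distributed G) φ = here refl

C-demand : ∀ G (φ : Form n L) {a} → a ∈ᴳ G →
           (knows a , φ) ∈ demands (C G φ) × (knows a , C G φ) ∈ demands (C G φ)
C-demand G φ a∈G =
  ∈-concatMap⁺ _ (lose (∈-agentList⁺ G a∈G) (here refl)) ,
  ∈-concatMap⁺ _ (lose (∈-agentList⁺ G a∈G) (there (here refl)))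

mutual
  subformulas : Form n L → List (Form n L)
  subformulas φ = φ ∷ properSubformulas φ

  properSubformulas : Form n L → List (Form n L)
  properSubformulas (var _) = []
  properSubformulas (~ φ)   = subformulas φ
  properSubformulas (φ ⇒ ψ) = subformulas φ ++ subformulas ψ
  properSubformulas (K _ φ) = subformulas φ
  properSubformulas (C _ φ) = subformulas φ
  properSubformulas (D _ φ) = subformulas φ
  properSubformulas (M _ φ) = subformulas φ

mutual
  subformulas-closed : ∀ (φ : Form n L) {ψ χ} → ψ ∈ subformulas φ →
                       χ ∈ properSubformulas ψ → χ ∈ subformulas φ
  subformulas-closed φ (here refl) χ∈ = there χ∈
  subformulas-closed φ (there ψ∈)  χ∈ = there (properSubformulas-closed φ ψ∈ χ∈)

  properSubformulas-closed : ∀ (φ : Form n L) {ψ χ} → ψ ∈ properSubformulas φ →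
                             χ ∈ properSubformulas ψ → χ ∈ properSubformulas φ
  properSubformulas-closed (~ φ)   ψ∈ χ∈ = subformulas-closed φ ψ∈ χ∈
  properSubformulas-closed (φ ⇒ φ′) ψ∈ χ∈ with ∈-++⁻ (subformulas φ) ψ∈
  ... | inj₁ ψ∈ˡ = ∈-++⁺ˡ (subformulas-closed φ ψ∈ˡ χ∈)
  ... | inj₂ ψ∈ʳ = ∈-++⁺ʳ (subformulas φ) (subformulas-closed φ′ ψ∈ʳ χ∈)
  properSubformulas-closed (K _ φ) ψ∈ χ∈ = subformulas-closed φ ψ∈ χ∈
  properSubformulas-closed (C _ φ) ψ∈ χ∈ = subformulas-closed φ ψ∈ χ∈
  properSubformulas-closed (D _ φ) ψ∈ χ∈ = subformulas-closed φ ψ∈ χ∈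
  properSubformulas-closed (M _ φ) ψ∈ χ∈ = subformulas-closed φ ψ∈ χ∈

box-subformula : ∀ (i : Modality n L) φ → φ ∈ properSubformulas (box i φ)
box-subformula (knows a)       φ = here refl
box-subformula (mutually G)    φ = here refl
box-subformula (distributed G) φ = here refl

-- Pruning of finite lists.

-- `Good` depends on the list that is left, so a removal may spoil other members and every round
-- surveys the whole list again; the length drops each time. The invariant, available to `examine`,
-- is that everything outside the list is `Removable`.
module Pruning {A : Set} (_≟ₐ_ : DecidableEquality A)
               (Removable : A → Set) (Good : List A → A → Set)
               (examine : ∀ Z → (∀ t → t ∉ Z → Removable t) →
                          ∀ s → s ∈ Z → Good Z s ⊎ Removable s) where

  private
    survey : ∀ {P Q : A → Set} Z → (∀ s → s ∈ Z → P s ⊎ Q s) →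
             (∀ s → s ∈ Z → P s) ⊎ ∃[ s ] s ∈ Z × Q s
    survey []      f = inj₁ λ _ ()
    survey (z ∷ Z) f with f z (here refl) | survey Z (λ s → f s ∘ there)
    ... | inj₂ q | _                  = inj₂ (z , here refl , q)
    ... | inj₁ p | inj₂ (s , s∈Z , q) = inj₂ (s , there s∈Z , q)
    ... | inj₁ p | inj₁ ps            = inj₁ λ { _ (here refl) → p ; s (there s∈) → ps s s∈ }

    loop : ∀ Z → Acc _<_ (length Z) → (∀ t → t ∉ Z → Removable t) →
           ∃[ S ] (∀ t → t ∉ S → Removable t) × (∀ s → s ∈ S → Good S s)
    loop Z (acc rec) out with survey Z (examine Z out)
    ... | inj₁ good          = Z , out , good
    ... | inj₂ (s , s∈Z , q) = loop (filter ≢s? Z) (rec shorter) out′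
      where
      ≢s? : ∀ t → Dec (t ≢ s)
      ≢s? t = ¬? (t ≟ₐ s)

      shorter : length (filter ≢s? Z) < length Z
      shorter = filter-notAll ≢s? Z (lose s∈Z (λ s≢s → s≢s refl))

      out′ : ∀ t → t ∉ filter ≢s? Z → Removable t
      out′ t t∉ with t ≟ₐ s
      ... | yes refl = q
      ... | no  t≢s  = out t (λ t∈Z → t∉ (∈-filter⁺ ≢s? t∈Z t≢s))

  prune : ∀ Z → (∀ t → t ∉ Z → Removable t) →
          ∃[ S ] (∀ t → t ∉ S → Removable t) × (∀ s → s ∈ S → Good S s)
  prune Z = loop Z (<-wellFounded _)

-- Natural deduction inside a Hilbert system.

module Calculus (S : System n L)
                (axiomK : ∀ {φ} → AxiomK φ → Axiom S φ)
                (ruleK : ∀ {Γ φ} → RuleK Γ φ → Rule S Γ φ) where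

  infixr 4 _⇒*_
  infix  3 _⊩_

  -- The head of Γ is the innermost antecedent, which makes the deduction
  -- theorem a definitional equality.
  _⇒*_ : List (Form n L) → Form n L → Form n L
  []      ⇒* φ = φ
  (γ ∷ Γ) ⇒* φ = Γ ⇒* (γ ⇒ φ)

  -- A record, so that unification recovers `Γ` and `φ`, which the formula `Γ ⇒* φ` does not
  -- determine.
  record _⊩_ (Γ : List (Form n L)) (φ : Form n L) : Set where
    constructor from
    field
      theorem : S ⊢ Γ ⇒* φ

  open _⊩_ public

  private
    substitution : Form n L → Form n L → Form n L → ℕ → Form n L
    substitution φ ψ χ 0 = φ
    substitution φ ψ χ 1 = ψ
    substitution φ ψ χ _ = χ

    byTautology : ∀ θ → Tautology θ → ∀ φ ψ χ → S ⊢ instantiate (substitution φ ψ χ) θ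
    byTautology θ t φ ψ χ = axiom (axiomK (taut θ t (substitution φ ψ χ)))

    p q r : PL
    p = atom 0
    q = atom 1
    r = atom 2

  falsum : Form n L
  falsum = ~ (var 0 ⇒ var 0)

  private
    axK : ∀ φ ψ → S ⊢ φ ⇒ ψ ⇒ φ
    axK φ ψ = byTautology (imp p (imp q p)) (λ v → table (v 0) (v 1)) φ ψ ψ
      where
      table : ∀ a b → not a ∨ (not b ∨ a) ≡ true
      table false _     = refl
      table true  false = refl
      table true  true  = refl

    axS : ∀ φ ψ χ → S ⊢ (φ ⇒ ψ ⇒ χ) ⇒ (φ ⇒ ψ) ⇒ φ ⇒ χ
    axS = byTautology (imp (imp p (imp q r)) (imp (imp p q) (imp p r)))
                      (λ v → table (v 0) (v 1) (v 2))
      where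
      table : ∀ a b c → not (not a ∨ (not b ∨ c)) ∨ (not (not a ∨ b) ∨ (not a ∨ c)) ≡ true
      table false _     _     = refl
      table true  false _     = refl
      table true  true  false = refl
      table true  true  true  = refl

    axRaa : ∀ φ → S ⊢ (~ φ ⇒ falsum) ⇒ φ
    axRaa φ = byTautology (imp (imp (neg p) (neg (imp q q))) p) (λ v → table (v 0) (v 1))
                          φ (var 0) φ
      where
      table : ∀ a b → not (not (not a) ∨ not (not b ∨ b)) ∨ a ≡ true
      table false false = refl
      table false true  = refl
      table true  false = refl
      table true  true  = refl

    axNeg : ∀ φ → S ⊢ (φ ⇒ falsum) ⇒ ~ φ
    axNeg φ = byTautology (imp (imp p (neg (imp q q))) (neg p)) (λ v → table (v 0) (v 1))
                          φ (var 0) φ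
      where
      table : ∀ a b → not (not a ∨ not (not b ∨ b)) ∨ not a ≡ true
      table false _     = refl
      table true  false = refl
      table true  true  = refl

    axContradiction : ∀ φ → S ⊢ φ ⇒ ~ φ ⇒ falsum
    axContradiction φ = byTautology (imp p (imp (neg p) (neg (imp q q))))
                                    (λ v → table (v 0) (v 1)) φ (var 0) φ
      where
      table : ∀ a b → not a ∨ (not (not a) ∨ not (not b ∨ b)) ≡ true
      table false _     = refl
      table true  false = refl
      table true  true  = refl

    mp₀ : ∀ {φ ψ} → S ⊢ φ ⇒ ψ → S ⊢ φ → S ⊢ ψ
    mp₀ d e = rule (ruleK (mp _ _)) (e ∷ d ∷ [])

  ded : ∀ {Γ φ ψ} → φ ∷ Γ ⊩ ψ → Γ ⊩ φ ⇒ ψ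
  ded (from d) = from d

  unded : ∀ {Γ φ ψ} → Γ ⊩ φ ⇒ ψ → φ ∷ Γ ⊩ ψ
  unded (from d) = from d

  mutual
    -- All three go by induction on the context: `axK` adds an antecedent, `axS` applies one
    -- implication beneath it.
    lift : ∀ {Γ φ} → S ⊢ φ → Γ ⊩ φ
    lift {[]}    d = from d
    lift {γ ∷ Γ} d = weaken (lift d)

    weaken : ∀ {Γ γ φ} → Γ ⊩ φ → γ ∷ Γ ⊩ φ
    weaken {Γ} d = unded (app {Γ} (lift (axK _ _)) d)

    app : ∀ {Γ φ ψ} → Γ ⊩ φ ⇒ ψ → Γ ⊩ φ → Γ ⊩ ψ
    app {[]}    (from d) (from e) = from (mp₀ d e)
    app {γ ∷ Γ} d        e        =
      unded (app {Γ} (app {Γ} (lift (axS _ _ _)) (ded d)) (ded e))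

  hyp : ∀ {Γ φ} → φ ∈ Γ → Γ ⊩ φ
  hyp {γ ∷ Γ} (here refl) = unded (self Γ)
    where
    self : ∀ Γ {φ} → Γ ⊩ φ ⇒ φ
    self Γ {φ} = app {Γ} (app {Γ} (lift (axS φ (φ ⇒ φ) φ)) (lift (axK _ _))) (lift (axK _ _))
  hyp {γ ∷ Γ} (there φ∈Γ) = weaken (hyp φ∈Γ)

  cut : ∀ {Γ Δ φ} → (∀ {γ} → γ ∈ Γ → Δ ⊩ γ) → Γ ⊩ φ → Δ ⊩ φ
  cut {[]}    f (from d) = lift d
  cut {γ ∷ Γ} f d        = app (cut (f ∘ there) (ded d)) (f (here refl))

  split : ∀ Γ {Δ φ} → Γ ++ Δ ⊩ φ → Δ ⊩ (Γ ⇒* φ)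
  split []      d = d
  split (γ ∷ Γ) d = split Γ (ded d)

  apply* : ∀ {Γ Δ φ} → (∀ {γ} → γ ∈ Γ → Δ ⊩ γ) → Δ ⊩ (Γ ⇒* φ) → Δ ⊩ φ
  apply* {[]}    f d = d
  apply* {γ ∷ Γ} f d = app (apply* {Γ} (f ∘ there) d) (f (here refl))

  raa : ∀ {Γ φ} → ~ φ ∷ Γ ⊩ falsum → Γ ⊩ φ
  raa d = app (lift (axRaa _)) (ded d)

  neg-intro : ∀ {Γ φ} → φ ∷ Γ ⊩ falsum → Γ ⊩ ~ φ
  neg-intro d = app (lift (axNeg _)) (ded d)

  contradict : ∀ {Γ φ} → Γ ⊩ φ → Γ ⊩ ~ φ → Γ ⊩ falsum
  contradict d e = app (app (lift (axContradiction _)) d) e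

  exfalso : ∀ {Γ φ} → Γ ⊩ falsum → Γ ⊩ φ
  exfalso d = raa (weaken d)

  ∧-intro : ∀ {Γ φ ψ} → Γ ⊩ φ → Γ ⊩ ψ → Γ ⊩ φ ∧ ψ
  ∧-intro d e = neg-intro (contradict (weaken e) (app (hyp (here refl)) (weaken d)))

  ∧-elim₁ : ∀ {Γ φ ψ} → Γ ⊩ φ ∧ ψ → Γ ⊩ φ
  ∧-elim₁ d = raa (contradict
    (ded (exfalso (contradict (hyp (here refl)) (hyp (there (here refl)))))) (weaken d))

  ∧-elim₂ : ∀ {Γ φ ψ} → Γ ⊩ φ ∧ ψ → Γ ⊩ ψ
  ∧-elim₂ d = raa (contradict (ded (weaken (hyp (here refl)))) (weaken d))

  ⋀-intro : ∀ {Γ} G (f : Fin n → Form n L) → (∀ a → a ∈ᴳ G → Γ ⊩ f a) → Γ ⊩ ⋀[ G ] f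
  ⋀-intro {Γ} G@(group p ne) f d =
    go (elements p) (elements-nonempty p ne) (λ a a∈ → d a (∈-agentList⁻ G a∈))
    where
    go : ∀ as .(as≢[] : as ≢ []) → (∀ a → a ∈ as → Γ ⊩ f a) →
         Γ ⊩ foldr₁ _∧_ (List⁺.map f (toList⁺ as as≢[]))
    go []           as≢[] d = ⊥-elim-irr (as≢[] refl)
    go (a ∷ [])     _     d = d a (here refl)
    go (a ∷ b ∷ as) _     d = ∧-intro (d a (here refl)) (go (b ∷ as) (λ ()) (λ c → d c ∘ there))

  ⋀-elim : ∀ {Γ} G (f : Fin n → Form n L) → Γ ⊩ ⋀[ G ] f → ∀ a → a ∈ᴳ G → Γ ⊩ f a
  ⋀-elim {Γ} G@(group p ne) f d a a∈G =
    go (elements p) (elements-nonempty p ne) d (∈-agentList⁺ G a∈G)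
    where
    go : ∀ as .(as≢[] : as ≢ []) → Γ ⊩ foldr₁ _∧_ (List⁺.map f (toList⁺ as as≢[])) →
         a ∈ as → Γ ⊩ f a
    go (a ∷ [])     _ d (here refl) = d
    go (a ∷ b ∷ as) _ d (here refl) = ∧-elim₁ d
    go (a ∷ b ∷ as) _ d (there a∈)  = go (b ∷ as) (λ ()) (∧-elim₂ d) a∈

-- Normal modal logics with common knowledge.

-- What the construction asks of each of the four systems. Boxes become weaker as their holders grow
-- along `_⊑_`, which is inclusion for distributed knowledge and reversed inclusion for mutual
-- knowledge.
record NormalLogic (S : System n L) : Set₁ where
  field
    axiomK        : ∀ {φ} → AxiomK φ → Axiom S φ
    ruleK         : ∀ {Γ φ} → RuleK Γ φ → Rule S Γ φ
    axiomC        : ∀ {φ} → AxiomC φ → Axiom S φ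
    ruleC         : ∀ {Γ φ} → RuleC Γ φ → Rule S Γ φ
    distribution  : ∀ (i : Modality n L) φ ψ → S ⊢ box i (φ ⇒ ψ) ⇒ box i φ ⇒ box i ψ
    necessitation : ∀ (i : Modality n L) {φ} → S ⊢ φ → S ⊢ box i φ
    isSymmetric   : Bool
    symmetry      : T isSymmetric → ∀ (i : Modality n L) φ → S ⊢ φ ⇒ box i (~ box i (~ φ))
    _⊑_           : Subset n → Subset n → Set
    _⊑?_          : ∀ P Q → Dec (P ⊑ Q)
    ⊑-refl        : ∀ {P} → P ⊑ P
    ⊑-trans       : ∀ {P Q R} → P ⊑ Q → Q ⊑ R → P ⊑ R
    monotonicity  : ∀ (i j : Modality n L) φ → holders j ⊑ holders i → S ⊢ box j φ ⇒ box i φ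

-- States over the subformulas of `φ₀`.

module Canonical {S : System n L} (𝓛 : NormalLogic S) (φ₀ : Form n L) where
  open NormalLogic 𝓛
  open Calculus S axiomK ruleK
  open DecMembership (_≟_ {n} {L}) using (_∈?_)
  open DecMembership (List.≡-dec (_≟_ {n} {L})) using () renaming (_∈?_ to _∈ˢᵗ?_)

  Closure : List (Form n L)
  Closure = subformulas φ₀

  -- A state decides every formula of the closure: those it contains are true
  -- and all the others false.
  State : Set
  State = List (Form n L)

  _≟ˢᵗ_ : DecidableEquality State
  _≟ˢᵗ_ = List.≡-dec _≟_

  private
    extensions : List (Form n L) → State → List State
    extensions []      s = s ∷ []
    extensions (ψ ∷ Ψ) s = extensions Ψ (ψ ∷ s) ++ extensions Ψ s

  states : List State
  states = extensions Closure []

  -- Abstract, so that unification reads s off literals s.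
  abstract
    literal : State → Form n L → Form n L
    literal s ψ = if does (ψ ∈? s) then ψ else ~ ψ

    literals : State → List (Form n L)
    literals s = map (literal s) Closure

    true∈literals : ∀ {s ψ} → ψ ∈ Closure → ψ ∈ s → ψ ∈ literals s
    true∈literals {s} {ψ} ψ∈Cl ψ∈s with ψ ∈? s | ∈-map⁺ (literal s) ψ∈Cl
    ... | yes _   | ∈lits = ∈lits
    ... | no  ψ∉s | _     = ⊥-elim (ψ∉s ψ∈s)

    false∈literals : ∀ {s ψ} → ψ ∈ Closure → ψ ∉ s → ~ ψ ∈ literals s
    false∈literals {s} {ψ} ψ∈Cl ψ∉s with ψ ∈? s | ∈-map⁺ (literal s) ψ∈Cl
    ... | yes ψ∈s | _     = ⊥-elim (ψ∉s ψ∈s)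
    ... | no  _   | ∈lits = ∈lits

    ∈-literals⁻ : ∀ {s γ} → γ ∈ literals s →
                  ∃[ ψ ] ψ ∈ Closure × ((ψ ∈ s × γ ≡ ψ) ⊎ (ψ ∉ s × γ ≡ ~ ψ))
    ∈-literals⁻ {s} γ∈ with ∈-map⁻ (literal s) γ∈
    ... | ψ , ψ∈Cl , γ≡ with ψ ∈? s
    ...   | yes ψ∈s = ψ , ψ∈Cl , inj₁ (ψ∈s , γ≡)
    ...   | no  ψ∉s = ψ , ψ∈Cl , inj₂ (ψ∉s , γ≡)

  -- The negated conjunction of the literals of `s`, in curried form.
  Refutation : State → Form n L
  Refutation s = literals s ⇒* falsum

  Refuted : State → Set
  Refuted s = [] ⊩ Refutation s

  holds : ∀ {s Δ ψ} → ψ ∈ Closure → ψ ∈ s → literals s ++ Δ ⊩ ψ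
  holds ψ∈Cl ψ∈s = hyp (∈-++⁺ˡ (true∈literals ψ∈Cl ψ∈s))

  fails : ∀ {s Δ ψ} → ψ ∈ Closure → ψ ∉ s → literals s ++ Δ ⊩ ~ ψ
  fails ψ∈Cl ψ∉s = hyp (∈-++⁺ˡ (false∈literals ψ∈Cl ψ∉s))

  drop-[] : ∀ {s φ} → literals s ++ [] ⊩ φ → literals s ⊩ φ
  drop-[] {s} {φ} = subst (_⊩ φ) (List.++-identityʳ (literals s))

  holds′ : ∀ {s ψ} → ψ ∈ Closure → ψ ∈ s → literals s ⊩ ψ
  holds′ ψ∈Cl ψ∈s = hyp (true∈literals ψ∈Cl ψ∈s)

  fails′ : ∀ {s ψ} → ψ ∈ Closure → ψ ∉ s → literals s ⊩ ~ ψ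
  fails′ ψ∈Cl ψ∉s = hyp (false∈literals ψ∈Cl ψ∉s)

  inconsistent : ∀ {s} → literals s ⊩ falsum → Refuted s
  inconsistent {s} d = split (literals s) (cut (λ γ∈ → hyp (∈-++⁺ˡ γ∈)) d)

  -- Every valuation of the closure is a state, so refuting all states refutes Δ.
  refute-all : ∀ {Δ} → (∀ t → t ∈ states → Δ ⊩ Refutation t) → Δ ⊩ falsum
  refute-all ref = go Closure [] (λ _ ()) (λ _ ψ∈Cl _ → inj₂ ψ∈Cl) ref
    where
    -- `s` holds the formulas decided positively so far; a closure formula outside `s` is either
    -- refuted by `Δ` or still waits in `Ψ`. Each formula of `Ψ` is decided by a case distinction
    -- inside the calculus.
    go : ∀ {Δ} Ψ s → (∀ ψ → ψ ∈ s → Δ ⊩ ψ) →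
         (∀ ψ → ψ ∈ Closure → ψ ∉ s → (Δ ⊩ ~ ψ) ⊎ (ψ ∈ Ψ)) →
         (∀ t → t ∈ extensions Ψ s → Δ ⊩ Refutation t) → Δ ⊩ falsum
    go {Δ} [] s members⊩ others⊩ ref = apply* {literals s} prove (ref s (here refl))
      where
      prove : ∀ {γ} → γ ∈ literals s → Δ ⊩ γ
      prove γ∈ with ∈-literals⁻ γ∈
      ... | ψ , _    , inj₁ (ψ∈s , refl) = members⊩ ψ ψ∈s
      ... | ψ , ψ∈Cl , inj₂ (ψ∉s , refl) with others⊩ ψ ψ∈Cl ψ∉s
      ...   | inj₁ d = d
    go {Δ} (ψ ∷ Ψ) s members⊩ others⊩ ref = app (ded negative) (neg-intro positive)
      where
      positive : ψ ∷ Δ ⊩ falsum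
      positive = go Ψ (ψ ∷ s)
        (λ { _ (here refl) → hyp (here refl) ; χ (there χ∈s) → weaken (members⊩ χ χ∈s) })
        (λ χ χ∈Cl χ∉ → positive-others χ χ∉ (others⊩ χ χ∈Cl (χ∉ ∘ there)))
        (λ t t∈ → weaken (ref t (∈-++⁺ˡ t∈)))
        where
        positive-others : ∀ χ → χ ∉ ψ ∷ s → (Δ ⊩ ~ χ) ⊎ (χ ∈ ψ ∷ Ψ) → (ψ ∷ Δ ⊩ ~ χ) ⊎ (χ ∈ Ψ)
        positive-others χ χ∉ (inj₁ d)           = inj₁ (weaken d)
        positive-others χ χ∉ (inj₂ (here refl)) = ⊥-elim (χ∉ (here refl))
        positive-others χ χ∉ (inj₂ (there χ∈))  = inj₂ χ∈

      negative : ~ ψ ∷ Δ ⊩ falsum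
      negative = go Ψ s (λ χ χ∈s → weaken (members⊩ χ χ∈s))
        (λ χ χ∈Cl χ∉ → negative-others χ (others⊩ χ χ∈Cl χ∉))
        (λ t t∈ → weaken (ref t (∈-++⁺ʳ (extensions Ψ (ψ ∷ s)) t∈)))
        where
        negative-others : ∀ χ → (Δ ⊩ ~ χ) ⊎ (χ ∈ ψ ∷ Ψ) → (~ ψ ∷ Δ ⊩ ~ χ) ⊎ (χ ∈ Ψ)
        negative-others χ (inj₁ d)           = inj₁ (weaken d)
        negative-others χ (inj₂ (here refl)) = inj₁ (hyp (here refl))
        negative-others χ (inj₂ (there χ∈))  = inj₂ χ∈

  -- Boxes, demands and arrows.

  box-lift : ∀ i {Γ Δ φ} → (∀ {γ} → γ ∈ Γ → Δ ⊩ box i γ) → Γ ⊩ φ → Δ ⊩ box i φ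
  box-lift i {[]}    f (from d) = lift (necessitation i d)
  box-lift i {γ ∷ Γ} f d        =
    app (app (lift (distribution i _ _)) (box-lift i (f ∘ there) (ded d))) (f (here refl))

  box-map : ∀ i {Δ φ ψ} → φ ∷ [] ⊩ ψ → Δ ⊩ box i φ → Δ ⊩ box i ψ
  box-map i d e = box-lift i (λ { (here refl) → e }) d

  box-nec : ∀ i {Δ φ} → [] ⊩ φ → Δ ⊩ box i φ
  box-nec i = box-lift i (λ ())

  demand-sound : ∀ α {i β} → (i , β) ∈ demands α → S ⊢ α ⇒ box i β
  demand-sound (K a φ) (here refl) = theorem {[]} (ded (hyp (here refl)))
  demand-sound (D G φ) (here refl) = theorem {[]} (ded (hyp (here refl)))
  demand-sound (M G φ) (here refl) = theorem {[]} (ded (hyp (here refl)))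
  demand-sound (C G φ) {i} {β} iβ∈ with find (∈-concatMap⁻ _ {xs = agentList G} iβ∈)
  ... | a , a∈ , iβ∈ₐ = theorem {[]} (ded (component iβ∈ₐ))
    where
    unfolded : C G φ ∷ [] ⊩ K a (φ ∧ C G φ)
    unfolded = ⋀-elim G (λ a → K a (φ ∧ C G φ))
                 (unded (lift (axiom (axiomC (unfold G φ))))) a (∈-agentList⁻ G a∈)

    component : (i , β) ∈ (knows a , φ) ∷ (knows a , C G φ) ∷ [] → C G φ ∷ [] ⊩ box i β
    component (here refl)         = box-map (knows a) (∧-elim₁ (hyp (here refl))) unfolded
    component (there (here refl)) = box-map (knows a) (∧-elim₂ (hyp (here refl))) unfolded

  -- `C G φ` demands `φ` and itself, with the boxes `K a` kept outside the formulas, so the plain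
  -- subformulas are closed under demands.
  demand-closure : ∀ {α i β} → α ∈ Closure → (i , β) ∈ demands α → β ∈ Closure
  demand-closure {K a φ} α∈ (here refl) = subformulas-closed φ₀ α∈ (here refl)
  demand-closure {D G φ} α∈ (here refl) = subformulas-closed φ₀ α∈ (here refl)
  demand-closure {M G φ} α∈ (here refl) = subformulas-closed φ₀ α∈ (here refl)
  demand-closure {C G φ} α∈ iβ∈ with find (∈-concatMap⁻ _ {xs = agentList G} iβ∈)
  ... | a , a∈ , here refl         = subformulas-closed φ₀ α∈ (here refl)
  ... | a , a∈ , there (here refl) = α∈

  -- The second alternative is the same violation read from `t` back to `s`; it makes `Arrow`
  -- symmetric by construction when the logic is.
  Violates : Subset n → State → State → Form n L → Modality n L × Form n L → Set
  Violates P s t α (j , β) =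
    holders j ⊑ P × ((α ∈ s × β ∉ t) ⊎ (T isSymmetric × α ∈ t × β ∉ s))

  Conflict : Subset n → State → State → Set
  Conflict P s t = Any (λ α → Any (Violates P s t α) (demands α)) Closure

  conflict? : ∀ P s t → Dec (Conflict P s t)
  conflict? P s t = any? (λ α → any? (λ (j , β) →
    (holders j ⊑? P) ×-dec ((α ∈? s ×-dec ¬? (β ∈? t)) ⊎-dec
                            (T? isSymmetric ×-dec α ∈? t ×-dec ¬? (β ∈? s)))) (demands α)) Closure

  -- As many arrows as the demands permit: a missing one always comes with a violated demand, from
  -- which `no-arrow` builds a derivation.
  Arrow : Subset n → State → State → Set
  Arrow P s t = ¬ Conflict P s t

  arrow? : ∀ P s t → Dec (Arrow P s t)
  arrow? P s t = ¬? (conflict? P s t)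

  arrow-respects : ∀ {P s t α j β} → Arrow P s t → α ∈ Closure → (j , β) ∈ demands α →
                   holders j ⊑ P → α ∈ s → β ∈ t
  arrow-respects {t = t} {β = β} arr α∈Cl jβ∈ j⊑P α∈s =
    decidable-stable (β ∈? t) λ β∉t → arr (lose α∈Cl (lose jβ∈ (j⊑P , inj₁ (α∈s , β∉t))))

  arrow-mono : ∀ {P Q s t} → P ⊑ Q → Arrow Q s t → Arrow P s t
  arrow-mono P⊑Q arr = arr ∘ Any.map (Any.map λ (j⊑P , v) → ⊑-trans j⊑P P⊑Q , v)

  arrow-sym : T isSymmetric → ∀ {P s t} → Arrow P s t → Arrow P t s
  arrow-sym B arr = arr ∘ Any.map (Any.map (map₂ Sum.[ (λ v → inj₂ (B , v)) , (λ (_ , v) → inj₁ v) ]))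

  -- If a demand of `s` is violated, `s` proves `box i β` while `~ β` is a literal of `t`. If a
  -- demand of `t` is violated, symmetry turns the literal `~ β` of `s` into
  -- `box i (~ box i (~ ~ β))`, whereas `t` proves `box i (~ ~ β)`.
  no-arrow : ∀ i {s t} → ¬ Arrow (holders i) s t → literals s ⊩ box i (Refutation t)
  no-arrow i {s} {t} ¬arr
    with α , α∈Cl , v ← find (decidable-stable (conflict? (holders i) s t) ¬arr)
    with (j , β) , jβ∈ , j⊑i , w ← find v
    with β∈Cl ← demand-closure α∈Cl jβ∈
    with w
  ... | inj₁ (α∈s , β∉t) =
    box-map i (split (literals t) (contradict (hyp (∈-++⁺ʳ (literals t) (here refl))) (fails β∈Cl β∉t)))
      (app (lift (monotonicity i j β j⊑i)) (app (lift (demand-sound α jβ∈)) (holds′ α∈Cl α∈s)))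
  ... | inj₂ (B , α∈t , β∉s) =
    box-map i (split (literals t) (contradict box-¬¬β (hyp (∈-++⁺ʳ (literals t) (here refl)))))
      (app (lift (symmetry B i (~ β))) (fails′ β∈Cl β∉s))
    where
    box-¬¬β : literals t ++ ~ box i (~ ~ β) ∷ [] ⊩ box i (~ ~ β)
    box-¬¬β = box-map i (neg-intro (contradict (hyp (there (here refl))) (hyp (here refl))))
      (app (lift (monotonicity i j β j⊑i)) (app (lift (demand-sound α jβ∈)) (holds α∈Cl α∈t)))

  -- In both cases `~ φ ⇒ Refutation u` is provable under the box. As the states exhaust all
  -- valuations, these implications together yield `φ`.
  box-by-states : ∀ i {s φ} →
    (∀ u → u ∈ states → (literals u ⊩ φ) ⊎ (literals s ⊩ box i (Refutation u))) →
    literals s ⊩ box i φ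
  box-by-states i {s} {φ} f = box-lift i boxed covered
    where
    alternative : State → Form n L
    alternative u = ~ φ ⇒ Refutation u

    boxed : ∀ {γ} → γ ∈ map alternative states → literals s ⊩ box i γ
    boxed γ∈ with ∈-map⁻ alternative γ∈
    ... | u , u∈ , refl with f u u∈
    ...   | inj₁ d = box-nec i (ded (split (literals u)
                       (contradict (cut (λ γ∈ → hyp (∈-++⁺ˡ γ∈)) d)
                                   (hyp (∈-++⁺ʳ (literals u) (here refl))))))
    ...   | inj₂ d = box-map i (ded (weaken (hyp (here refl)))) d

    covered : map alternative states ⊩ φ
    covered = raa (refute-all λ u u∈ → app (weaken (hyp (∈-map⁺ alternative u∈))) (hyp (here refl)))

  -- Conditions on the surviving states.

  data Path (Z : List State) (G : Group n) (φ : Form n L) (s : State) : Set where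
    last : ∀ {a t} → a ∈ᴳ G → t ∈ Z → Arrow ⁅ a ⁆ s t → φ ∉ t → Path Z G φ s
    step : ∀ {a t} → a ∈ᴳ G → t ∈ Z → Arrow ⁅ a ⁆ s t → Path Z G φ t → Path Z G φ s

  GoodBox : List State → State → Modality n L → Form n L → Set
  GoodBox Z s i φ = box i φ ∉ s → ∃[ t ] t ∈ Z × Arrow (holders i) s t × φ ∉ t

  -- For modal formulas only falsity imposes a condition; a true one is honoured by every arrow, by
  -- the choice of `Arrow`.
  Good : List State → State → Form n L → Set
  Good Z s (var p) = ⊤
  Good Z s (~ φ)   = (~ φ ∈ s → φ ∉ s) × (~ φ ∉ s → φ ∈ s)
  Good Z s (φ ⇒ ψ) = (φ ⇒ ψ ∈ s → φ ∈ s → ψ ∈ s) × (φ ⇒ ψ ∉ s → φ ∈ s × ψ ∉ s)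
  Good Z s (K a φ) = GoodBox Z s (knows a) φ
  Good Z s (C G φ) = C G φ ∉ s → Path Z G φ s
  Good Z s (D G φ) = GoodBox Z s (distributed G) φ
  Good Z s (M G φ) = GoodBox Z s (mutually G) φ

  module _ (Z : List State) (refuted : ∀ t → t ∉ Z → t ∈ states → Refuted t) where

    -- Without a witness, each state contains `φ`, is refuted already, or has its refutation boxed
    -- by `no-arrow`. Then `box-by-states` proves `box i φ`, against its falsity at `s`.
    good-box : ∀ s i φ → box i φ ∈ Closure → GoodBox Z s i φ ⊎ Refuted s
    good-box s i φ □φ∈Cl with box i φ ∈? s
    ... | yes □φ∈s = inj₁ λ □φ∉s → ⊥-elim (□φ∉s □φ∈s)
    ... | no  □φ∉s with any? (λ t → arrow? (holders i) s t ×-dec ¬? (φ ∈? t)) Z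
    ...   | yes found = inj₁ λ _ → find found
    ...   | no  none  = inj₂ (inconsistent (contradict (box-by-states i examine) (fails′ □φ∈Cl □φ∉s)))
      where
      examine : ∀ u → u ∈ states → (literals u ⊩ φ) ⊎ (literals s ⊩ box i (Refutation u))
      examine u u∈ with φ ∈? u | u ∈ˢᵗ? Z | arrow? (holders i) s u
      ... | yes φ∈u | _       | _        = inj₁ (holds′ (subformulas-closed φ₀ □φ∈Cl (box-subformula i φ)) φ∈u)
      ... | no  _   | no  u∉Z | _        = inj₂ (box-nec i (refuted u u∉Z u∈))
      ... | no  _   | yes _   | no  ¬arr = inj₂ (no-arrow i ¬arr)
      ... | no  φ∉u | yes u∈Z | yes arr  = ⊥-elim (none (lose u∈Z (arr , φ∉u)))

    module _ (G : Group n) (φ : Form n L) where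

      Confined : List State → State → Set
      Confined Y s = ∀ a → a ∈ᴳ G → ∀ t → t ∈ Z → Arrow ⁅ a ⁆ s t → φ ∈ t × t ∈ Y

      private
        examine : ∀ Y → (∀ t → t ∉ Y → t ∈ Z → Path Z G φ t) → ∀ s → s ∈ Y →
                  Confined Y s ⊎ (s ∈ Z → Path Z G φ s)
        examine Y escapes s s∈Y with any? (λ a → any? (λ t →
          arrow? ⁅ a ⁆ s t ×-dec (¬? (φ ∈? t) ⊎-dec ¬? (t ∈ˢᵗ? Y))) Z) (agentList G)
        ... | no none = inj₁ λ a a∈G t t∈Z arr →
          decidable-stable (φ ∈? t) (λ φ∉t →
            none (lose (∈-agentList⁺ G a∈G) (lose t∈Z (arr , inj₁ φ∉t)))) ,
          decidable-stable (t ∈ˢᵗ? Y) (λ t∉Y →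
            none (lose (∈-agentList⁺ G a∈G) (lose t∈Z (arr , inj₂ t∉Y))))
        ... | yes found with a , a∈ , found′ ← find found
                        with find found′
        ...   | t , t∈Z , arr , inj₁ φ∉t = inj₂ λ _ → last (∈-agentList⁻ G a∈) t∈Z arr φ∉t
        ...   | t , t∈Z , arr , inj₂ t∉Y =
          inj₂ λ _ → step (∈-agentList⁻ G a∈) t∈Z arr (escapes t t∉Y t∈Z)

      -- Pruning a second time, now by the existence of a path: a state that is not confined has an
      -- arrow to a failure of `φ`, or to a state discarded earlier whose path it prolongs.
      confinement : ∃[ Y ] (∀ t → t ∉ Y → t ∈ Z → Path Z G φ t) × (∀ s → s ∈ Y → Confined Y s)
      confinement = Pruning.prune _≟ˢᵗ_ (λ t → t ∈ Z → Path Z G φ t) Confined examine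
                      Z (λ t t∉Z t∈Z → ⊥-elim (t∉Z t∈Z))

      -- The disjunction of the states in Y is an invariant for the induction rule.
      confined-C : C G φ ∈ Closure → ∀ Y → (∀ s → s ∈ Y → Confined Y s) →
                   ∀ s → s ∈ Y → literals s ⊩ C G φ
      confined-C Cφ∈Cl Y confined s s∈Y = app (lift invariant⇒C) (drop-[] (satisfies s∈Y))
        where
        φ∈Cl : φ ∈ Closure
        φ∈Cl = subformulas-closed φ₀ Cφ∈Cl (here refl)

        -- A disjunction written with implications: not all states of `Y` are refuted.
        invariant : Form n L
        invariant = map Refutation Y ⇒* falsum

        satisfies : ∀ {t Δ} → t ∈ Y → literals t ++ Δ ⊩ invariant
        satisfies {t} {Δ} t∈Y = split (map Refutation Y)
          (apply* {literals t} (λ γ∈ → hyp (∈-++⁺ʳ (map Refutation Y) (∈-++⁺ˡ γ∈)))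
                  (hyp (∈-++⁺ˡ (∈-map⁺ Refutation t∈Y))))

        -- Arrows from `t` into `Z` stay in `Y` by confinement; all other states have their
        -- refutation boxed.
        preserved : ∀ a → a ∈ᴳ G → ∀ t → t ∈ Y → literals t ⊩ K a (invariant ∧ φ)
        preserved a a∈G t t∈Y = box-by-states (knows a) successor
          where
          successor : ∀ u → u ∈ states →
                      (literals u ⊩ invariant ∧ φ) ⊎ (literals t ⊩ K a (Refutation u))
          successor u u∈ with u ∈ˢᵗ? Z | arrow? ⁅ a ⁆ t u
          ... | no  u∉Z | _        = inj₂ (box-nec (knows a) (refuted u u∉Z u∈))
          ... | yes _   | no  ¬arr = inj₂ (no-arrow (knows a) ¬arr)
          ... | yes u∈Z | yes arr  with confined t t∈Y a a∈G u u∈Z arr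
          ...   | φ∈u , u∈Y = inj₁ (∧-intro (drop-[] (satisfies u∈Y)) (holds′ φ∈Cl φ∈u))

        invariant⇒C : S ⊢ invariant ⇒ C G φ
        invariant⇒C = rule (ruleC (induct G invariant φ)) (theorem {[]} (ded
          (⋀-intro G (λ a → K a (invariant ∧ φ)) λ a a∈G →
            -- If `K a (invariant ∧ φ)` failed, `preserved` would refute every state in `Y`, against
            -- `invariant`.
            raa (apply* {map Refutation Y} (escape a a∈G) (hyp (there (here refl)))))) ∷ [])
          where
          escape : ∀ a → a ∈ᴳ G → ∀ {γ} → γ ∈ map Refutation Y →
                   ~ K a (invariant ∧ φ) ∷ invariant ∷ [] ⊩ γ
          escape a a∈G γ∈ with ∈-map⁻ Refutation γ∈
          ... | t , t∈Y , refl = split (literals t)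
            (contradict (cut (λ γ∈ → hyp (∈-++⁺ˡ γ∈)) (preserved a a∈G t t∈Y))
                        (hyp (∈-++⁺ʳ (literals t) (here refl))))

    good-C : ∀ s → s ∈ Z → ∀ G φ → C G φ ∈ Closure → (C G φ ∉ s → Path Z G φ s) ⊎ Refuted s
    good-C s s∈Z G φ Cφ∈Cl with C G φ ∈? s | confinement G φ
    ... | yes Cφ∈s | _ = inj₁ λ Cφ∉s → ⊥-elim (Cφ∉s Cφ∈s)
    ... | no  Cφ∉s | Y , escapes , confined with s ∈ˢᵗ? Y
    ...   | no  s∉Y = inj₁ λ _ → escapes s s∉Y s∈Z
    ...   | yes s∈Y = inj₂ (inconsistent (contradict (confined-C G φ Cφ∈Cl Y confined s s∈Y)
                                                     (fails′ Cφ∈Cl Cφ∉s)))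

    good : ∀ s → s ∈ Z → ∀ φ → φ ∈ Closure → Good Z s φ ⊎ Refuted s
    good s s∈Z (var p) φ∈ = inj₁ tt
    good s s∈Z (~ φ) ~φ∈ with φ∈ ← subformulas-closed φ₀ ~φ∈ (here refl) | ~ φ ∈? s | φ ∈? s
    ... | yes ~φ∈s | yes φ∈s =
      inj₂ (inconsistent (contradict (holds′ φ∈ φ∈s) (holds′ ~φ∈ ~φ∈s)))
    ... | no ~φ∉s | no φ∉s =
      inj₂ (inconsistent (contradict (fails′ φ∈ φ∉s) (fails′ ~φ∈ ~φ∉s)))
    ... | yes ~φ∈s | no φ∉s = inj₁ ((λ _ → φ∉s) , λ ~φ∉s → ⊥-elim (~φ∉s ~φ∈s))
    ... | no ~φ∉s | yes φ∈s = inj₁ ((λ ~φ∈s → ⊥-elim (~φ∉s ~φ∈s)) , λ _ → φ∈s)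
    good s s∈Z (φ ⇒ ψ) φψ∈
      with φ∈ ← subformulas-closed φ₀ φψ∈ (here refl)
         | ψ∈ ← subformulas-closed φ₀ φψ∈ (∈-++⁺ʳ (subformulas φ) (here refl))
         | φ ⇒ ψ ∈? s | φ ∈? s | ψ ∈? s
    ... | yes φψ∈s | yes φ∈s | no ψ∉s =
      inj₂ (inconsistent (contradict (app (holds′ φψ∈ φψ∈s) (holds′ φ∈ φ∈s)) (fails′ ψ∈ ψ∉s)))
    ... | yes φψ∈s | yes _ | yes ψ∈s = inj₁ ((λ _ _ → ψ∈s) , λ φψ∉s → ⊥-elim (φψ∉s φψ∈s))
    ... | yes φψ∈s | no φ∉s | _ =
      inj₁ ((λ _ φ∈s → ⊥-elim (φ∉s φ∈s)) , λ φψ∉s → ⊥-elim (φψ∉s φψ∈s))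
    ... | no φψ∉s | yes φ∈s | no ψ∉s =
      inj₁ ((λ φψ∈s → ⊥-elim (φψ∉s φψ∈s)) , λ _ → φ∈s , ψ∉s)
    ... | no φψ∉s | _ | yes ψ∈s =
      inj₂ (inconsistent (contradict (ded (weaken (holds′ ψ∈ ψ∈s))) (fails′ φψ∈ φψ∉s)))
    ... | no φψ∉s | no φ∉s | no _ =
      inj₂ (inconsistent (contradict
        (ded (exfalso (contradict (hyp (here refl)) (weaken (fails′ φ∈ φ∉s))))) (fails′ φψ∈ φψ∉s)))
    good s s∈Z (K a φ) φ∈ = good-box s (knows a) φ φ∈
    good s s∈Z (C G φ) φ∈ = good-C s s∈Z G φ φ∈
    good s s∈Z (D G φ) φ∈ = good-box s (distributed G) φ φ∈
    good s s∈Z (M G φ) φ∈ = good-box s (mutually G) φ φ∈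

    all-good : ∀ s → s ∈ Z → (∀ φ → φ ∈ Closure → Good Z s φ) ⊎ Refuted s
    all-good s s∈Z = go Closure (good s s∈Z)
      where
      go : ∀ Ψ → (∀ φ → φ ∈ Ψ → Good Z s φ ⊎ Refuted s) → (∀ φ → φ ∈ Ψ → Good Z s φ) ⊎ Refuted s
      go []      f = inj₁ λ _ ()
      go (ψ ∷ Ψ) f with f ψ (here refl) | go Ψ (λ φ → f φ ∘ there)
      ... | inj₂ r | _      = inj₂ r
      ... | inj₁ _ | inj₂ r = inj₂ r
      ... | inj₁ g | inj₁ h = inj₁ λ { _ (here refl) → g ; φ (there φ∈) → h φ φ∈ }

  private
    pruned : ∃[ Z ] (∀ t → t ∉ Z → t ∈ states → Refuted t) ×
                    (∀ s → s ∈ Z → ∀ φ → φ ∈ Closure → Good Z s φ)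
    -- The premise `t ∈ states` makes the invariant vacuous at the start; lists that are no states
    -- lie outside every `Z` with no refutation at hand.
    pruned = Pruning.prune _≟ˢᵗ_ (λ t → t ∈ states → Refuted t)
      (λ Z s → ∀ φ → φ ∈ Closure → Good Z s φ)
      (λ Z refuted s s∈Z → Sum.map₂ (λ r _ → r) (all-good Z refuted s s∈Z))
      states (λ t t∉ t∈ → ⊥-elim (t∉ t∈))

  abstract
    survivors : List State
    survivors = proj₁ pruned

    others-refuted : ∀ t → t ∉ survivors → t ∈ states → Refuted t
    others-refuted = proj₁ (proj₂ pruned)

    survivors-good : ∀ s → s ∈ survivors → ∀ φ → φ ∈ Closure → Good survivors s φ
    survivors-good = proj₂ (proj₂ pruned)

  -- Under the assumption `~ φ₀` the survivors are refuted too, so every valuation is.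
  provable : (∀ s → s ∈ survivors → φ₀ ∈ s) → S ⊢ φ₀
  provable φ₀∈ = theorem {[]} (raa (refute-all refute))
    where
    refute : ∀ t → t ∈ states → ~ φ₀ ∷ [] ⊩ Refutation t
    refute t t∈ with t ∈ˢᵗ? survivors
    ... | no  t∉Z = weaken (others-refuted t t∉Z t∈)
    ... | yes t∈Z = split (literals t) (contradict (holds (here refl) (φ₀∈ t t∈Z))
                                                   (hyp (∈-++⁺ʳ (literals t) (here refl))))

-- Truth in a realization.

module _ (𝓜 : Model n) where
  open Model 𝓜

  required : Modality n L → A → Set
  required (knows a)       = cap a
  required (mutually G)    = ⋂cap G
  required (distributed G) = ⋃cap G

  ⋀-Sem⁺ : ∀ G (f : Fin n → W → Set) {s} → (∀ a → a ∈ᴳ G → f a s) → Sem.⋀[ G ] f s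
  ⋀-Sem⁺ G@(group p ne) f {s} h =
    go (elements p) (elements-nonempty p ne) (λ a a∈ → h a (∈-agentList⁻ G a∈))
    where
    go : ∀ as .(as≢[] : as ≢ []) → (∀ a → a ∈ as → f a s) →
         foldr₁ Sem._∧_ (List⁺.map f (toList⁺ as as≢[])) s
    go []           as≢[] h = ⊥-elim-irr (as≢[] refl)
    go (a ∷ [])     _     h = h a (here refl)
    go (a ∷ b ∷ as) _     h = λ k → k (h a (here refl)) (go (b ∷ as) (λ ()) (λ c → h c ∘ there))

  -- The semantic conjunction is `¬ (x → ¬ y)`, from which a component follows constructively only
  -- up to double negation. This suffices for refuting `E^`.
  ⋀-Sem⁻ : ∀ G (f : Fin n → W → Set) {s} → Sem.⋀[ G ] f s → ∀ a → a ∈ᴳ G → ¬ ¬ f a s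
  ⋀-Sem⁻ G@(group p ne) f {s} h a a∈G =
    go (elements p) (elements-nonempty p ne) h (∈-agentList⁺ G a∈G)
    where
    go : ∀ as .(as≢[] : as ≢ []) → foldr₁ Sem._∧_ (List⁺.map f (toList⁺ as as≢[])) s →
         a ∈ as → ¬ ¬ f a s
    go (a ∷ [])     _ h (here refl) ¬fa = ¬fa h
    go (a ∷ b ∷ as) _ h (here refl) ¬fa = h λ fa _ → ¬fa fa
    go (a ∷ b ∷ as) _ h (there a∈)  ¬fa = h λ _ rest → go (b ∷ as) (λ ()) rest a∈ ¬fa

-- A model whose worlds lie over the surviving states by a bounded morphism.
record Realization {S : System n L} (𝓛 : NormalLogic S) (φ₀ : Form n L) (𝓜 : Model n) : Set where
  open NormalLogic 𝓛
  open Canonical 𝓛 φ₀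
  open Model 𝓜
  field
    state : W → State
    val⁺  : ∀ {s p} → var p ∈ state s → val s p
    val⁻  : ∀ {s p} → val s p → var p ∈ state s
    forth : ∀ (i : Modality n L) {s t} → (∀ {x} → required 𝓜 i x → edge s t x) →
            state t ∈ survivors × Arrow (holders i) (state s) (state t)
    back  : ∀ (i : Modality n L) {s u} → state s ∈ survivors → u ∈ survivors →
            Arrow (holders i) (state s) u →
            ∃[ t ] state t ≡ u × (∀ {x} → required 𝓜 i x → edge s t x)

module Truth {S : System n L} {𝓛 : NormalLogic S} {φ₀ : Form n L} {𝓜 : Model n}
             (𝓡 : Realization 𝓛 φ₀ 𝓜) where
  open NormalLogic 𝓛
  open Canonical 𝓛 φ₀
  open Model 𝓜
  open Realization 𝓡

  -- Both halves start from membership, which is decidable, unlike satisfaction; the converses are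
  -- recovered through `decidable-stable`.
  TruthAt : Form n L → W → Set
  TruthAt φ s = (φ ∈ state s → Sat φ s) × (φ ∉ state s → ¬ Sat φ s)

  private
    forth-demand : ∀ {i α β} → α ∈ Closure → (i , β) ∈ demands α →
                   ∀ {s t} → (∀ {x} → required 𝓜 i x → edge s t x) → α ∈ state s → β ∈ state t
    forth-demand {i} α∈Cl iβ∈ reach = arrow-respects (proj₂ (forth i reach)) α∈Cl iβ∈ ⊑-refl

  -- `forth` yields an arrow, which respects the demand of a true box; `back` turns the witness
  -- against a false box into a world.
  truth-box : ∀ i φ {s} → box i φ ∈ Closure → state s ∈ survivors →
              (∀ {t} → state t ∈ survivors → TruthAt φ t) → GoodBox survivors (state s) i φ →
              (box i φ ∈ state s → Box (required 𝓜 i) (Sat φ) s) ×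
              (box i φ ∉ state s → ¬ Box (required 𝓜 i) (Sat φ) s)
  truth-box i φ {s} □φ∈Cl s∈ truthφ good = positive , negative
    where
    positive : box i φ ∈ state s → Box (required 𝓜 i) (Sat φ) s
    positive □φ∈s t reach =
      proj₁ (truthφ (proj₁ (forth i reach))) (forth-demand □φ∈Cl (box-demand i φ) reach □φ∈s)

    negative : box i φ ∉ state s → ¬ Box (required 𝓜 i) (Sat φ) s
    negative □φ∉s sat with good □φ∉s
    ... | u , u∈ , arr , φ∉u with back i s∈ u∈ arr
    ...   | t , refl , reach = proj₂ (truthφ u∈) φ∉u (sat t reach)

  -- A true `C G φ` passes `φ` and itself along every arrow of a member of `G`, which gives each
  -- `E^` by induction. A false one has a path, and a path of `suc m` arrows refutes `E^ (suc m)`.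
  truth-C : ∀ G φ {s} → C G φ ∈ Closure → state s ∈ survivors →
            (∀ {t} → state t ∈ survivors → TruthAt φ t) →
            (C G φ ∉ state s → Path survivors G φ (state s)) → TruthAt (C G φ) s
  truth-C G φ Cφ∈Cl s∈ truthφ good =
    (λ { Cφ∈s (suc m) _ → positive m Cφ∈s }) , λ Cφ∉s → negative s∈ (good Cφ∉s)
    where
    positive : ∀ m {s} → C G φ ∈ state s → Sem.E^ (suc m) G (Sat φ) s
    positive m {s} Cφ∈s =
      ⋀-Sem⁺ 𝓜 G (λ a → Box (cap a) (Sem.E^ m G (Sat φ))) λ a a∈G t reach → at m a∈G reach
      where
      at : ∀ m {a t} → a ∈ᴳ G → (∀ {x} → cap a x → edge s t x) → Sem.E^ m G (Sat φ) t
      at zero {a} a∈G reach = proj₁ (truthφ (proj₁ (forth (knows a) reach)))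
        (forth-demand Cφ∈Cl (proj₁ (C-demand G φ a∈G)) reach Cφ∈s)
      at (suc m) a∈G reach = positive m (forth-demand Cφ∈Cl (proj₂ (C-demand G φ a∈G)) reach Cφ∈s)

    unreachable : ∀ {s} → state s ∈ survivors → Path survivors G φ (state s) →
                  ∃[ m ] ¬ Sem.E^ (suc m) G (Sat φ) s
    unreachable s∈ (last {a} a∈G u∈ arr φ∉u) with back (knows a) s∈ u∈ arr
    ... | t , refl , reach = 0 , λ sat →
      ⋀-Sem⁻ 𝓜 G (λ b → Box (cap b) (Sat φ)) sat a a∈G λ boxed → proj₂ (truthφ u∈) φ∉u (boxed t reach)
    unreachable s∈ (step {a} a∈G u∈ arr path) with back (knows a) s∈ u∈ arr
    ... | t , refl , reach with unreachable u∈ path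
    ...   | m , ¬E = suc m , λ sat → ⋀-Sem⁻ 𝓜 G (λ b → Box (cap b) (Sem.E^ (suc m) G (Sat φ))) sat a a∈G
        λ boxed → ¬E (boxed t reach)

    negative : ∀ {s} → state s ∈ survivors → Path survivors G φ (state s) → ¬ Sat (C G φ) s
    negative s∈ path sat with unreachable s∈ path
    ... | m , ¬E = ¬E (sat (suc m) (s≤s z≤n))

  truth : ∀ φ {s} → φ ∈ Closure → state s ∈ survivors → TruthAt φ s
  truth (var p) _ _ = val⁺ , λ p∉s sat → p∉s (val⁻ sat)
  truth (~ φ) ~φ∈ s∈ with truth φ (subformulas-closed φ₀ ~φ∈ (here refl)) s∈
                        | survivors-good _ s∈ (~ φ) ~φ∈
  ... | φ⁺ , φ⁻ | true⇒ , false⇒ = φ⁻ ∘ true⇒ , λ ~φ∉s sat → sat (φ⁺ (false⇒ ~φ∉s))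
  truth (φ ⇒ ψ) {s} φψ∈ s∈
    with truth φ (subformulas-closed φ₀ φψ∈ (here refl)) s∈
       | truth ψ (subformulas-closed φ₀ φψ∈ (∈-++⁺ʳ (subformulas φ) (here refl))) s∈
       | survivors-good _ s∈ (φ ⇒ ψ) φψ∈
  ... | φ⁺ , φ⁻ | ψ⁺ , ψ⁻ | true⇒ , false⇒ =
    (λ φψ∈s satφ → ψ⁺ (true⇒ φψ∈s (decidable-stable (φ ∈? state s) λ φ∉s → φ⁻ φ∉s satφ))) ,
    (λ φψ∉s sat → ψ⁻ (proj₂ (false⇒ φψ∉s)) (sat (φ⁺ (proj₁ (false⇒ φψ∉s)))))
    where open DecMembership (_≟_ {n} {L}) using (_∈?_)
  truth (K a φ) φ∈ s∈ = truth-box (knows a) φ φ∈ s∈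
    (truth φ (subformulas-closed φ₀ φ∈ (here refl))) (survivors-good _ s∈ (K a φ) φ∈)
  truth (C G φ) φ∈ s∈ = truth-C G φ φ∈ s∈
    (truth φ (subformulas-closed φ₀ φ∈ (here refl))) (survivors-good _ s∈ (C G φ) φ∈)
  truth (D G φ) φ∈ s∈ = truth-box (distributed G) φ φ∈ s∈
    (truth φ (subformulas-closed φ₀ φ∈ (here refl))) (survivors-good _ s∈ (D G φ) φ∈)
  truth (M G φ) φ∈ s∈ = truth-box (mutually G) φ φ∈ s∈
    (truth φ (subformulas-closed φ₀ φ∈ (here refl))) (survivors-good _ s∈ (M G φ) φ∈)

  completeness : (∀ u → u ∈ survivors → ∃[ s ] state s ≡ u × Sat φ₀ s) → S ⊢ φ₀
  completeness sat = provable λ u u∈ → contains u∈ (sat u u∈)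
    where
    open DecMembership (_≟_ {n} {L}) using (_∈?_)

    contains : ∀ {u} → u ∈ survivors → ∃[ s ] state s ≡ u × Sat φ₀ s → φ₀ ∈ u
    contains u∈ (s , refl , satφ₀) =
      decidable-stable (φ₀ ∈? state s) λ φ₀∉s → proj₂ (truth φ₀ (here refl) u∈) φ₀∉s satφ₀

-- A model for mutual knowledge.

-- The capabilities are the sets of agents; a has those it belongs to, so that
-- G's common capabilities are the supersets of G.  The capability `nothing` is
-- never on an edge, which makes full⇒≡ vacuous.
module MutualModel {S : System n L} (𝓛 : NormalLogic S) (φ₀ : Form n L)
  (L≢ELCD : L ≢ ELCD) (⊆⇒⊒ : ∀ {P Q} → P Subset.⊆ Q → NormalLogic._⊑_ 𝓛 Q P) where
  open NormalLogic 𝓛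
  open Canonical 𝓛 φ₀

  private
    Edge : State → State → Maybe (Subset n) → Set
    Edge s t nothing  = ⊥
    Edge s t (just P) = s ∈ survivors × t ∈ survivors × Arrow P s t

    Cap : Fin n → Maybe (Subset n) → Set
    Cap a nothing  = ⊥
    Cap a (just P) = a Subset.∈ P

  model : Model n
  model = record
    { W = State ; point = [] ; A = Maybe (Subset n)
    ; edge = Edge ; cap = Cap ; val = λ s p → var p ∈ s }

  similarity : T isSymmetric → IsSimilarity model
  similarity sy = record
    { full⇒≡    = λ s t full → ⊥-elim (proj₂ full {nothing} tt)
    ; symmetric = λ s t → (λ {x} → flip x) , (λ {x} → flip x) }
    where
    flip : ∀ {s t} x → Edge s t x → Edge t s x
    flip (just P) (s∈ , t∈ , arr) = t∈ , s∈ , arrow-sym sy arr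

  private
    Reach : Modality n L → State → State → Set
    Reach i s t = ∀ {x} → required model i x → Edge s t x

    forth : ∀ (i : Modality n L) {s t} → Reach i s t → t ∈ survivors × Arrow (holders i) s t
    -- The set of holders is the least capability that `i` requires, and its presence on the edge is
    -- the arrow sought.
    forth (knows a)       reach = proj₂ (reach {just ⁅ a ⁆} (x∈⁅x⁆ a))
    forth (mutually G)    reach = proj₂ (reach {just (members G)} (λ a a∈G → a∈G))
    forth (distributed G) reach = ⊥-elim (L≢ELCD refl)

    -- Every required capability contains the holders, and by `⊆⇒⊒` an arrow for the holders is one
    -- for each larger set.
    back : ∀ (i : Modality n L) {s u} → s ∈ survivors → u ∈ survivors → Arrow (holders i) s u →
           ∃[ t ] t ≡ u × Reach i s t
    back (knows a) {s} {u} s∈ u∈ arr = u , refl , λ {x} → reach x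
      where
      reach : ∀ x → Cap a x → Edge s u x
      reach (just P) a∈P =
        s∈ , u∈ , arrow-mono (⊆⇒⊒ λ b∈ → subst (Subset._∈ P) (sym (x∈⁅y⁆⇒x≡y a b∈)) a∈P) arr
    back (mutually G) {s} {u} s∈ u∈ arr = u , refl , λ {x} → reach x
      where
      reach : ∀ x → Model.⋂cap model G x → Edge s u x
      -- Here nonemptiness of the group enters: an empty intersection would contain `nothing`.
      reach nothing  common with a , a∈G ← someMember G = ⊥-elim (common a a∈G)
      reach (just P) common = s∈ , u∈ , arrow-mono (⊆⇒⊒ (common _)) arr
    back (distributed G) _ _ _ = ⊥-elim (L≢ELCD refl)

  complete : (∀ s → model , s ⊨ φ₀) → S ⊢ φ₀
  complete valid = Truth.completeness realization λ u _ → u , refl , valid u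
    where
    realization : Realization 𝓛 φ₀ model
    realization = record { state = id ; val⁺ = id ; val⁻ = id ; forth = forth ; back = back }

-- Symmetric differences and a model for distributed knowledge.

_⊻_ : Subset n → Subset n → Subset n
_⊻_ = Vec.zipWith _xor_

⊻-comm : (P Q : Subset n) → P ⊻ Q ≡ Q ⊻ P
⊻-comm = VecP.zipWith-comm Bool.xor-comm

⊻-cancelˡ : (P Q : Subset n) → P ⊻ (P ⊻ Q) ≡ Q
⊻-cancelˡ []      []      = refl
⊻-cancelˡ (x ∷ P) (y ∷ Q) = cong₂ _∷_ (cancel x y) (⊻-cancelˡ P Q)
  where
  cancel : ∀ x y → x xor (x xor y) ≡ y
  cancel false _     = refl
  cancel true  false = refl
  cancel true  true  = refl

-- Every state is copied once for each set of agents, and edges between the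
-- copies P and Q carry the label P ⊻ Q only.  Without this, s and t could be
-- related for every member of G separately but not for D_G.
module DistributedModel {S : System n L} (𝓛 : NormalLogic S) (φ₀ : Form n L)
  (L≢ELCM : L ≢ ELCM) (⊆⇒⊑ : ∀ {P Q} → P Subset.⊆ Q → NormalLogic._⊑_ 𝓛 P Q) where
  open NormalLogic 𝓛
  open Canonical 𝓛 φ₀

  private
    World : Set
    World = State × Subset n

    Edge : World → World → Maybe (Fin n) → Set
    Edge _       _       nothing  = ⊥
    Edge (s , P) (t , Q) (just a) =
      a Subset.∈ P ⊻ Q × s ∈ survivors × t ∈ survivors × Arrow (P ⊻ Q) s t

  model : Model n
  model = record
    { W = World ; point = [] , Subset.⊥ ; A = Maybe (Fin n)
    ; edge = Edge ; cap = λ a x → x ≡ just a ; val = λ (s , _) p → var p ∈ s }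

  similarity : T isSymmetric → IsSimilarity model
  similarity sy = record
    { full⇒≡    = λ s t full → ⊥-elim (proj₂ full {nothing} tt)
    ; symmetric = λ s t → (λ {x} → flip s t x) , (λ {x} → flip t s x) }
    where
    flip : ∀ s t x → Edge s t x → Edge t s x
    flip (s , P) (t , Q) (just a) (a∈ , s∈ , t∈ , arr) rewrite ⊻-comm P Q =
      a∈ , t∈ , s∈ , arrow-sym sy arr

  private
    Reach : Modality n L → World → World → Set
    Reach i s t = ∀ {x} → required model i x → Edge s t x

    -- All of `R` lies in the label `P ⊻ Q`, so the arrow for the label restricts to `R`. The member
    -- `a` supplies the edge from which that arrow is read off.
    arrows : ∀ {P s Q t R a} → a Subset.∈ R → (∀ {b} → b Subset.∈ R → Edge (s , P) (t , Q) (just b)) →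
             t ∈ survivors × Arrow R s t
    arrows a∈R edges with edges a∈R
    ... | _ , _ , t∈ , arr = t∈ , arrow-mono (⊆⇒⊑ (proj₁ ∘ edges)) arr

    forth : ∀ (i : Modality n L) {s t} → Reach i s t →
            proj₁ t ∈ survivors × Arrow (holders i) (proj₁ s) (proj₁ t)
    forth (knows a) {s} {t} reach =
      arrows (x∈⁅x⁆ a) (λ b∈ → subst (Edge s t ∘ just) (sym (x∈⁅y⁆⇒x≡y a b∈)) (reach refl))
    forth (distributed G) reach with a , a∈G ← someMember G =
      arrows a∈G (λ {b} b∈G → reach (b , b∈G , refl))
    forth (mutually G) reach = ⊥-elim (L≢ELCM refl)

    back : ∀ (i : Modality n L) {s u} → proj₁ s ∈ survivors → u ∈ survivors →
           Arrow (holders i) (proj₁ s) u → ∃[ t ] proj₁ t ≡ u × Reach i s t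
    -- In this copy of `u` the label seen from `P` is exactly `holders i`, by `⊻-cancelˡ`.
    back i {s , P} {u} s∈ u∈ arr = (u , P ⊻ holders i) , refl , λ {x} → reach x
      where
      edge : ∀ {a} → a Subset.∈ holders i → Edge (s , P) (u , P ⊻ holders i) (just a)
      edge a∈ rewrite ⊻-cancelˡ P (holders i) = a∈ , s∈ , u∈ , arr

      needed : ∀ (i : Modality n L) x → required model i x → ∃[ a ] x ≡ just a × a Subset.∈ holders i
      needed (knows a)       _ refl             = a , refl , x∈⁅x⁆ a
      needed (distributed G) _ (a , a∈G , refl) = a , refl , a∈G
      needed (mutually G)    _ _                = ⊥-elim (L≢ELCM refl)

      reach : ∀ x → required model i x → Edge (s , P) (u , P ⊻ holders i) x
      reach x req with needed i x req
      ... | a , refl , a∈ = edge a∈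

  complete : (∀ s → model , s ⊨ φ₀) → S ⊢ φ₀
  complete valid = Truth.completeness realization λ u _ →
    (u , Subset.⊥) , refl , valid (u , Subset.⊥)
    where
    realization : Realization 𝓛 φ₀ model
    realization = record { state = proj₁ ; val⁺ = id ; val⁻ = id ; forth = forth ; back = back }

-- The four systems as normal logics.

-- All holders are singletons here, where inclusion in either direction is equality; reversed
-- inclusion is the order that `MutualModel` expects.
logicELC : NormalLogic {n} {ELC} 𝐊𝐁[𝐂]
logicELC {n} = record
  { axiomK        = inj₁ ∘ inj₁
  ; ruleK         = inj₁ ∘ inj₁
  ; axiomC        = inj₂
  ; ruleC         = inj₂
  ; distribution  = λ { (knows a) φ ψ → axiom (inj₁ (inj₁ (dist a φ ψ))) }
  ; necessitation = λ { (knows a) {φ} d → rule (inj₁ (inj₁ (nec a φ))) (d ∷ []) }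
  ; isSymmetric   = true
  ; symmetry      = λ { _ (knows a) φ → axiom (inj₁ (inj₂ (symm a φ))) }
  ; _⊑_           = λ P Q → Q Subset.⊆ P
  ; _⊑?_          = λ P Q → Q ⊆? P
  ; ⊑-refl        = id
  ; ⊑-trans       = λ P⊇Q Q⊇R → P⊇Q ∘ Q⊇R
  ; monotonicity  = monotone
  }
  where
  open Calculus {n} {ELC} 𝐊𝐁[𝐂] (inj₁ ∘ inj₁) (inj₁ ∘ inj₁)

  monotone : ∀ (i j : Modality n ELC) φ → holders i Subset.⊆ holders j → 𝐊𝐁[𝐂] ⊢ box j φ ⇒ box i φ
  monotone (knows a) (knows b) φ a⊆b with x∈⁅y⁆⇒x≡y b (a⊆b (x∈⁅x⁆ a))
  ... | refl = theorem {[]} (ded (hyp (here refl)))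

module _ (S : System n ELCM)
         (axK : ∀ {φ} → AxiomK φ → Axiom S φ) (rlK : ∀ {Γ φ} → RuleK Γ φ → Rule S Γ φ)
         (axC : ∀ {φ} → AxiomC φ → Axiom S φ) (rlC : ∀ {Γ φ} → RuleC Γ φ → Rule S Γ φ)
         (axM : ∀ {φ} → AxiomM φ → Axiom S φ) (rlM : ∀ {Γ φ} → RuleM Γ φ → Rule S Γ φ)
         (sym? : Bool)
         (axB : T sym? → ∀ (i : Modality n ELCM) φ → S ⊢ φ ⇒ box i (~ box i (~ φ))) where
  open Calculus S axK rlK

  private
    group-of : Modality n ELCM → Group n
    group-of (knows a)    = singleton a
    group-of (mutually G) = G

    box⇒M : ∀ i φ → box i φ ∷ [] ⊩ M (group-of i) φ
    box⇒M (knows a)    φ = unded (∧-elim₂ (lift (axiom (axM (sing a φ)))))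
    box⇒M (mutually G) φ = hyp (here refl)

    M⇒box : ∀ i φ → M (group-of i) φ ∷ [] ⊩ box i φ
    M⇒box (knows a)    φ = unded (∧-elim₁ (lift (axiom (axM (sing a φ)))))
    M⇒box (mutually G) φ = hyp (here refl)

    holders-of : ∀ i → holders i ≡ members (group-of i)
    holders-of (knows a)    = refl
    holders-of (mutually G) = refl

    -- Exchanging `K a` with `M` of a singleton reduces every pair of modalities to the axiom
    -- `anti`.
    monotone : ∀ i j φ → holders i Subset.⊆ holders j → S ⊢ box j φ ⇒ box i φ
    monotone i j φ i⊆j rewrite holders-of i | holders-of j =
      theorem {[]} (ded (cut (λ { (here refl) → shrink }) (M⇒box i φ)))
      where
      shrink : box j φ ∷ [] ⊩ M (group-of i) φ
      shrink = app (lift (axiom (axM (anti (group-of j) (group-of i) φ i⊆j)))) (box⇒M j φ)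

  logicELCM : NormalLogic S
  logicELCM = record
    { axiomK        = axK
    ; ruleK         = rlK
    ; axiomC        = axC
    ; ruleC         = rlC
    ; distribution  = λ { (knows a)    φ ψ → axiom (axK (dist a φ ψ))
                        ; (mutually G) φ ψ → axiom (axM (dist G φ ψ)) }
    ; necessitation = λ { (knows a)    {φ} d → rule (rlK (nec a φ)) (d ∷ [])
                        ; (mutually G) {φ} d → rule (rlM (nec G φ)) (d ∷ []) }
    ; isSymmetric   = sym?
    ; symmetry      = axB
    ; _⊑_           = λ P Q → Q Subset.⊆ P
    ; _⊑?_          = λ P Q → Q ⊆? P
    ; ⊑-refl        = id
    ; ⊑-trans       = λ P⊇Q Q⊇R → P⊇Q ∘ Q⊇R
    ; monotonicity  = monotone
    }

logicELCM-𝐊 : NormalLogic {n} 𝐊[𝐂𝐌]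
logicELCM-𝐊 = logicELCM 𝐊[𝐂𝐌] (inj₁ ∘ inj₁) (inj₁ ∘ inj₁) (inj₁ ∘ inj₂) (inj₁ ∘ inj₂) inj₂ inj₂
                        false (λ ())

logicELCM-𝐊𝐁 : NormalLogic {n} 𝐊𝐁[𝐂𝐌]
logicELCM-𝐊𝐁 = logicELCM 𝐊𝐁[𝐂𝐌] (inj₁ ∘ inj₁ ∘ inj₁) (inj₁ ∘ inj₁ ∘ inj₁) (inj₁ ∘ inj₂) (inj₁ ∘ inj₂)
                         (inj₂ ∘ inj₁) (inj₂ ∘ inj₁) true
  λ { _ (knows a)    φ → axiom (inj₁ (inj₁ (inj₂ (symm a φ))))
    ; _ (mutually G) φ → axiom (inj₂ (inj₂ (symm G φ))) }

logicELCD : NormalLogic {n} 𝐊𝐁[𝐂𝐃]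
logicELCD {n} = record
  { axiomK        = inj₁ ∘ inj₁ ∘ inj₁
  ; ruleK         = inj₁ ∘ inj₁ ∘ inj₁
  ; axiomC        = inj₁ ∘ inj₂
  ; ruleC         = inj₁ ∘ inj₂
  ; distribution  = λ { (knows a)       φ ψ → axiom (inj₁ (inj₁ (inj₁ (dist a φ ψ))))
                      ; (distributed G) φ ψ → axiom (inj₂ (dist G φ ψ)) }
  ; necessitation = λ { (knows a)       d → nec-K a d
                      ; (distributed G) d → nec-D G d }
  ; isSymmetric   = true
  ; symmetry      = λ { _ (knows a)       φ → axiom (inj₁ (inj₁ (inj₂ (symm a φ))))
                      ; _ (distributed G) φ → axiom (inj₂ (symm G φ)) }
  ; _⊑_           = Subset._⊆_
  ; _⊑?_          = _⊆?_
  ; ⊑-refl        = id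
  ; ⊑-trans       = λ P⊆Q Q⊆R → Q⊆R ∘ P⊆Q
  ; monotonicity  = monotone
  }
  where
  open Calculus {n} {ELCD} 𝐊𝐁[𝐂𝐃] (inj₁ ∘ inj₁ ∘ inj₁) (inj₁ ∘ inj₁ ∘ inj₁)

  group-of : Modality n ELCD → Group n
  group-of (knows a)       = singleton a
  group-of (distributed G) = G

  box⇒D : ∀ i φ → box i φ ∷ [] ⊩ D (group-of i) φ
  box⇒D (knows a)       φ = unded (∧-elim₂ (lift (axiom (inj₂ (sing a φ)))))
  box⇒D (distributed G) φ = hyp (here refl)

  D⇒box : ∀ i φ → D (group-of i) φ ∷ [] ⊩ box i φ
  D⇒box (knows a)       φ = unded (∧-elim₁ (lift (axiom (inj₂ (sing a φ)))))
  D⇒box (distributed G) φ = hyp (here refl)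

  holders-of : ∀ i → holders i ≡ members (group-of i)
  holders-of (knows a)       = refl
  holders-of (distributed G) = refl

  monotone : ∀ (i j : Modality n ELCD) φ → holders j Subset.⊆ holders i → 𝐊𝐁[𝐂𝐃] ⊢ box j φ ⇒ box i φ
  monotone i j φ j⊆i rewrite holders-of i | holders-of j =
    theorem {[]} (ded (cut (λ { (here refl) → grow }) (D⇒box i φ)))
    where
    grow : box j φ ∷ [] ⊩ D (group-of i) φ
    grow = app (lift (axiom (inj₂ (mono (group-of j) (group-of i) φ j⊆i)))) (box⇒D j φ)

  nec-K : ∀ a {φ} → 𝐊𝐁[𝐂𝐃] ⊢ φ → 𝐊𝐁[𝐂𝐃] ⊢ K a φ
  nec-K a {φ} d = rule (inj₁ (inj₁ (inj₁ (nec a φ)))) (d ∷ [])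

  -- Necessitation for any member `a`, followed by monotonicity from `K a` to `D G`.
  nec-D : ∀ G {φ} → 𝐊𝐁[𝐂𝐃] ⊢ φ → 𝐊𝐁[𝐂𝐃] ⊢ D G φ
  nec-D G {φ} d with a , a∈G ← someMember G =
    theorem {[]} (app (lift (monotone (distributed G) (knows a) φ ⁅a⁆⊆G)) (lift (nec-K a d)))
    where
    ⁅a⁆⊆G : ⁅ a ⁆ Subset.⊆ members G
    ⁅a⁆⊆G b∈ = subst (_∈ᴳ G) (sym (x∈⁅y⁆⇒x≡y a b∈)) a∈G

-- Weak completeness of the four systems.

theorem48 : (n : ℕ) → .{{_ : NonZero n}} →
    ((φ : Form n ELC) → SValid φ → 𝐊𝐁[𝐂] ⊢ φ) ×
    ((φ : Form n ELCM) → Valid φ → 𝐊[𝐂𝐌] ⊢ φ) ×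
    ((φ : Form n ELCM) → SValid φ → 𝐊𝐁[𝐂𝐌] ⊢ φ) ×
    ((φ : Form n ELCD) → SValid φ → 𝐊𝐁[𝐂𝐃] ⊢ φ)
theorem48 n = forELC , forELCM-𝐊 , forELCM-𝐊𝐁 , forELCD
  where
  forELC : (φ : Form n ELC) → SValid φ → 𝐊𝐁[𝐂] ⊢ φ
  forELC φ valid = complete (valid model (similarity tt))
    where open MutualModel logicELC φ (λ ()) (λ P⊆Q → P⊆Q)

  forELCM-𝐊 : (φ : Form n ELCM) → Valid φ → 𝐊[𝐂𝐌] ⊢ φ
  -- Without axiom B the edges need not be symmetric, which validity over all models permits.
  forELCM-𝐊 φ valid = complete (valid model)
    where open MutualModel logicELCM-𝐊 φ (λ ()) (λ P⊆Q → P⊆Q)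

  forELCM-𝐊𝐁 : (φ : Form n ELCM) → SValid φ → 𝐊𝐁[𝐂𝐌] ⊢ φ
  forELCM-𝐊𝐁 φ valid = complete (valid model (similarity tt))
    where open MutualModel logicELCM-𝐊𝐁 φ (λ ()) (λ P⊆Q → P⊆Q)

  forELCD : (φ : Form n ELCD) → SValid φ → 𝐊𝐁[𝐂𝐃] ⊢ φ
  forELCD φ valid = complete (valid model (similarity tt))
    where open DistributedModel logicELCD φ (λ ()) (λ P⊆Q → P⊆Q)
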